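{- Let $G$ be a unicyclic graph with $n \ge 4$ vertices and maximum degree $\Delta \ge 3$, and let $f : [1,\infty) \to \mathbb{R}$ be a convex function. Then $$ I_f(G) \ge f(\Delta) + (n-\Delta+1) f(2) + (\Delta-2) f(1), $$ and the inequality is attained (i.e., equality holds) if and only if $G \in \mathcal{H}_n^\Delta$.
   Context: All graphs are finite, connected, simple (no loops, no multiple edges) and have at least one edge. A unicyclic graph is a graph containing exactly one cycle. For a vertex $u$ of $G$, $d_u$ denotes its degree. For a function $f:[1,\infty)\to\mathbb{R}$, $I_f(G) = \sum_{u\in V(G)} f(d_u)$. For $n\ge 4$ and $3\le \Delta\le n-1$, $\mathcal{H}_n^\Delta$ is the set of graphs (up to isomorphism) obtained from a cycle $C_k$, with $3\le k\le n-\Delta+2$, by attaching to one and the same vertex of the cycle $\Delta-2$ paths of lengths $m_1,\dots,m_{\Delta-2}\ge 1$ (each path having that cycle vertex as an end-vertex, and the paths being otherwise disjoint from each other and from the cycle), where $k+m_1+\dots+m_{\Delta-2}=n$. Equivalently, $\mathcal{H}_n^\Delta$ is the set of unicyclic graphs with $n$ vertices whose degree sequence is $(\Delta,2,\dots,2,1,\dots,1)$ with $n-\Delta+1$ entries equal to $2$ and $\Delta-2$ entries equal to $1$.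
   Formalization: The direction "equality implies G in H_n^Δ" is stated for strictly convex f only, since it fails for merely convex f (e.g. constant f and a triangle with pendant vertices at two of its vertices); the inequality and "G in H_n^Δ implies equality" hold for every convex f. -}

module Defs where

open import Level using (0ℓ)
open import Data.Nat as ℕ using (ℕ; zero; suc; z≤n; s≤s)
import Data.Nat.Properties as ℕₚ
open import Data.Integer as ℤ using (+_)
import Data.Integer.Properties as ℤₚ
open import Data.Rational as ℚ using (ℚ; 0ℚ; 1ℚ; ½)
import Data.Rational.Properties as ℚₚ
open import Data.Rational.Solver using (module +-*-Solver)
import Data.Rational.Unnormalised as ℚᵘ
import Data.Rational.Unnormalised.Properties as ℚᵘₚ
open import Data.Fin using (Fin; toℕ)
open import Data.Product using (Σ; ∃; ∃₂; ∃-syntax; _×_; _,_; proj₁; proj₂)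
open import Data.Sum using (_⊎_; inj₁; inj₂)
open import Data.Vec using (Vec; []; _∷_; allFin; count; lookup)
open import Data.Vec.Properties using (lookup-allFin)
open import Data.Vec.Functional using (Vector; foldr)
open import Function.Bundles using (Func; _↔_; _⇔_; Inverse)
open import Function.Definitions using (Injective)
open import Relation.Binary.Bundles using (Setoid)
open import Relation.Binary.Core using (Rel)
open import Relation.Binary.Definitions using (Symmetric; Decidable)
import Relation.Binary.Construct.On as On
open import Relation.Binary.Construct.Closure.Symmetric
  using (SymClosure; fwd; bwd; symmetric)
open import Relation.Binary.Construct.Closure.ReflexiveTransitive
  using (Star; _◅_) renaming (ε to nil)
open import Relation.Binary.PropositionalEquality
  using (_≡_; refl; sym; trans; cong; cong₂; subst)
open import Relation.Nullary using (¬_; yes; no; contradiction)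
import Relation.Unary as U

open import Algebra.Properties.Monoid.Sum ℕₚ.+-0-monoid using (sum)

------------------------------------------------------------------------
-- The real numbers: Cauchy sequences of rationals, compared through
-- the setoid equality _≃_ (difference tends to 0).

Eventually : (ℕ → Set) → Set
Eventually P = ∃[ N ] (∀ n → N ℕ.≤ n → P n)

IsCauchy : (ℕ → ℚ) → Set
IsCauchy x = ∀ ε → 0ℚ ℚ.< ε →
  ∃[ N ] (∀ m n → N ℕ.≤ m → N ℕ.≤ n → ℚ.∣ x m ℚ.- x n ∣ ℚ.< ε)

record ℝ : Set where
  constructor mkℝ
  field
    seq    : ℕ → ℚ
    cauchy : IsCauchy seq
open ℝ public

infix 4 _≃_ _≤_ _<_ _#_

_≃_ : Rel ℝ 0ℓ
x ≃ y = ∀ ε → 0ℚ ℚ.< ε → Eventually λ n → ℚ.∣ seq x n ℚ.- seq y n ∣ ℚ.< ε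

_≤_ : Rel ℝ 0ℓ
x ≤ y = ∀ ε → 0ℚ ℚ.< ε → Eventually λ n → seq x n ℚ.< seq y n ℚ.+ ε

_<_ : Rel ℝ 0ℓ
x < y = ∃[ ε ] (0ℚ ℚ.< ε × Eventually λ n → seq x n ℚ.+ ε ℚ.< seq y n)

-- Constructive form of x ≠ y.
_#_ : Rel ℝ 0ℓ
x # y = x < y ⊎ y < x

private
  half-pos : ∀ {ε} → 0ℚ ℚ.< ε → 0ℚ ℚ.< ½ ℚ.* ε
  half-pos {ε} 0<ε = subst (ℚ._< ½ ℚ.* ε) (ℚₚ.*-zeroʳ ½) (ℚₚ.*-monoʳ-<-pos ½ 0<ε)

  halves : ∀ ε → ½ ℚ.* ε ℚ.+ ½ ℚ.* ε ≡ ε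
  halves ε = trans (sym (ℚₚ.*-distribʳ-+ ε ½ ½)) (ℚₚ.*-identityˡ ε)

  triangle : ∀ {ε} a b {c} → a ℚ.+ b ≡ c →
             ℚ.∣ a ∣ ℚ.< ½ ℚ.* ε → ℚ.∣ b ∣ ℚ.< ½ ℚ.* ε → ℚ.∣ c ∣ ℚ.< ε
  triangle {ε} a b refl p q = ℚₚ.≤-<-trans (ℚₚ.∣p+q∣≤∣p∣+∣q∣ a b)
    (subst (ℚ.∣ a ∣ ℚ.+ ℚ.∣ b ∣ ℚ.<_) (halves ε) (ℚₚ.+-mono-< p q))

  ∣p-p∣≡0 : ∀ p → ℚ.∣ p ℚ.- p ∣ ≡ 0ℚ
  ∣p-p∣≡0 p = cong ℚ.∣_∣ (ℚₚ.+-inverseʳ p)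

  ∣p-q∣≡∣q-p∣ : ∀ p q → ℚ.∣ p ℚ.- q ∣ ≡ ℚ.∣ q ℚ.- p ∣
  ∣p-q∣≡∣q-p∣ p q = trans (sym (ℚₚ.∣-p∣≡∣p∣ (p ℚ.- q)))
    (cong ℚ.∣_∣ (solve 2 (λ p q → :- (p :- q) := q :- p) refl p q))
    where open +-*-Solver

  telescope : ∀ p q r → (p ℚ.- q) ℚ.+ (q ℚ.- r) ≡ p ℚ.- r
  telescope = solve 3 (λ p q r → (p :- q) :+ (q :- r) := p :- r) refl
    where open +-*-Solver

≃-setoid : Setoid 0ℓ 0ℓ
≃-setoid = record
  { Carrier       = ℝ
  ; _≈_           = _≃_
  ; isEquivalence = record
    { refl  = λ {x} ε 0<ε → 0 , λ n _ →
        subst (ℚ._< ε) (sym (∣p-p∣≡0 (seq x n))) 0<ε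
    ; sym   = λ {x} {y} x≃y ε 0<ε → let N , p = x≃y ε 0<ε in N , λ n N≤n →
        subst (ℚ._< ε) (∣p-q∣≡∣q-p∣ (seq x n) (seq y n)) (p n N≤n)
    ; trans = λ {x} {y} {z} x≃y y≃z ε 0<ε →
        let M , p = x≃y (½ ℚ.* ε) (half-pos 0<ε)
            N , q = y≃z (½ ℚ.* ε) (half-pos 0<ε)
        in M ℕ.⊔ N , λ n M⊔N≤n →
          triangle (seq x n ℚ.- seq y n) (seq y n ℚ.- seq z n)
            (telescope (seq x n) (seq y n) (seq z n))
            (p n (ℕₚ.m⊔n≤o⇒m≤o M N M⊔N≤n))
            (q n (ℕₚ.m⊔n≤o⇒n≤o M N M⊔N≤n))
    }
  }

fromℚ : ℚ → ℝ
fromℚ p = mkℝ (λ _ → p) λ ε 0<ε → 0 , λ _ _ _ _ →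
  subst (ℚ._< ε) (sym (∣p-p∣≡0 p)) 0<ε

fromℕ : ℕ → ℝ
fromℕ n = fromℚ (+ n ℚ./ 1)

0ℝ 1ℝ : ℝ
0ℝ = fromℕ 0
1ℝ = fromℕ 1

infixl 6 _+_ _-_
infixl 7 _*_
infix  8 -_

_+_ : ℝ → ℝ → ℝ
x + y = mkℝ (λ n → seq x n ℚ.+ seq y n) λ ε 0<ε →
  let M , p = cauchy x (½ ℚ.* ε) (half-pos 0<ε)
      N , q = cauchy y (½ ℚ.* ε) (half-pos 0<ε)
  in M ℕ.⊔ N , λ m n ≤m ≤n →
    triangle (seq x m ℚ.- seq x n) (seq y m ℚ.- seq y n)
      (regroup (seq x m) (seq x n) (seq y m) (seq y n))
      (p m n (ℕₚ.m⊔n≤o⇒m≤o M N ≤m) (ℕₚ.m⊔n≤o⇒m≤o M N ≤n))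
      (q m n (ℕₚ.m⊔n≤o⇒n≤o M N ≤m) (ℕₚ.m⊔n≤o⇒n≤o M N ≤n))
  where
  open +-*-Solver
  regroup : ∀ a b c d → (a ℚ.- b) ℚ.+ (c ℚ.- d) ≡ (a ℚ.+ c) ℚ.- (b ℚ.+ d)
  regroup = solve 4 (λ a b c d →
    (a :- b) :+ (c :- d) := (a :+ c) :- (b :+ d)) refl

-_ : ℝ → ℝ
- x = mkℝ (λ n → ℚ.- seq x n) λ ε 0<ε →
  let N , p = cauchy x ε 0<ε
  in N , λ m n ≤m ≤n → subst (ℚ._< ε) (flip (seq x m) (seq x n)) (p m n ≤m ≤n)
  where
  open +-*-Solver
  flip : ∀ a b → ℚ.∣ a ℚ.- b ∣ ≡ ℚ.∣ ℚ.- a ℚ.- (ℚ.- b) ∣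
  flip a b = trans (∣p-q∣≡∣q-p∣ a b)
    (cong ℚ.∣_∣ (solve 2 (λ a b → b :- a := :- a :- (:- b)) refl a b))

_-_ : ℝ → ℝ → ℝ
x - y = x + - y

private
  eventually-bounded : ∀ x → ∃[ B ] (0ℚ ℚ.< B × Eventually λ n → ℚ.∣ seq x n ∣ ℚ.≤ B)
  eventually-bounded x with cauchy x 1ℚ (ℚₚ.positive⁻¹ 1ℚ)
  ... | N , p = 1ℚ ℚ.+ ℚ.∣ a ∣ ,
      ℚₚ.+-mono-<-≤ (ℚₚ.positive⁻¹ 1ℚ) (ℚₚ.0≤∣p∣ a) ,
      N , λ n N≤n → begin
        ℚ.∣ seq x n ∣                        ≡⟨ cong ℚ.∣_∣ (split (seq x n) a) ⟩
        ℚ.∣ (seq x n ℚ.- a) ℚ.+ a ∣          ≤⟨ ℚₚ.∣p+q∣≤∣p∣+∣q∣ (seq x n ℚ.- a) a ⟩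
        ℚ.∣ seq x n ℚ.- a ∣ ℚ.+ ℚ.∣ a ∣      ≤⟨ ℚₚ.+-monoˡ-≤ ℚ.∣ a ∣ (ℚₚ.<⇒≤ (p n N N≤n ℕₚ.≤-refl)) ⟩
        1ℚ ℚ.+ ℚ.∣ a ∣                       ∎
    where
    open ℚₚ.≤-Reasoning
    open +-*-Solver
    a = seq x N
    split : ∀ q a → q ≡ (q ℚ.- a) ℚ.+ a
    split = solve 2 (λ q a → q := (q :- a) :+ a) refl

  -- A tolerance δ that survives multiplication by B.
  shrink : ∀ B ε → 0ℚ ℚ.< B → 0ℚ ℚ.< ε → ∃[ δ ] (0ℚ ℚ.< δ × B ℚ.* δ ≡ ε)
  shrink B ε 0<B 0<ε = ℚ.1/ B ℚ.* ε ,
    ℚₚ.positive⁻¹ _ {{ℚₚ.pos*pos⇒pos (ℚ.1/ B) {{ℚₚ.1/pos⇒pos B}} ε}} ,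
    trans (sym (ℚₚ.*-assoc B (ℚ.1/ B) ε))
      (trans (cong (ℚ._* ε) (ℚₚ.*-inverseʳ B)) (ℚₚ.*-identityˡ ε))
    where instance
      B-pos : ℚ.Positive B
      B-pos = ℚ.positive 0<B
      B-nonZero : ℚ.NonZero B
      B-nonZero = ℚₚ.pos⇒nonZero B
      ε-pos : ℚ.Positive ε
      ε-pos = ℚ.positive 0<ε

  ∣pq∣-bound : ∀ {B δ ε} p q → 0ℚ ℚ.< B → B ℚ.* δ ≡ ε →
               ℚ.∣ p ∣ ℚ.≤ B → ℚ.∣ q ∣ ℚ.< δ → ℚ.∣ p ℚ.* q ∣ ℚ.< ε
  ∣pq∣-bound {B} {δ} {ε} p q 0<B Bδ≡ε p≤B q<δ = begin-strict
    ℚ.∣ p ℚ.* q ∣          ≡⟨ ℚₚ.∣p*q∣≡∣p∣*∣q∣ p q ⟩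
    ℚ.∣ p ∣ ℚ.* ℚ.∣ q ∣    ≤⟨ ℚₚ.*-monoʳ-≤-nonNeg ℚ.∣ q ∣ {{ℚₚ.∣-∣-nonNeg q}} p≤B ⟩
    B ℚ.* ℚ.∣ q ∣          <⟨ ℚₚ.*-monoʳ-<-pos B {{ℚ.positive 0<B}} q<δ ⟩
    B ℚ.* δ                ≡⟨ Bδ≡ε ⟩
    ε                      ∎
    where open ℚₚ.≤-Reasoning

_*_ : ℝ → ℝ → ℝ
x * y = mkℝ (λ n → seq x n ℚ.* seq y n) λ ε 0<ε →
  let Bx , 0<Bx , K , bx   = eventually-bounded x
      By , 0<By , L , by   = eventually-bounded y
      δy , 0<δy , Bxδy≡½ε = shrink Bx (½ ℚ.* ε) 0<Bx (half-pos 0<ε)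
      δx , 0<δx , Byδx≡½ε = shrink By (½ ℚ.* ε) 0<By (half-pos 0<ε)
      M , p = cauchy x δx 0<δx
      N , q = cauchy y δy 0<δy
      KL = K ℕ.⊔ L
      MN = M ℕ.⊔ N
      ≥K = λ {i} (h : KL ℕ.⊔ MN ℕ.≤ i) → ℕₚ.m⊔n≤o⇒m≤o K L (ℕₚ.m⊔n≤o⇒m≤o KL MN h)
      ≥L = λ {i} (h : KL ℕ.⊔ MN ℕ.≤ i) → ℕₚ.m⊔n≤o⇒n≤o K L (ℕₚ.m⊔n≤o⇒m≤o KL MN h)
      ≥M = λ {i} (h : KL ℕ.⊔ MN ℕ.≤ i) → ℕₚ.m⊔n≤o⇒m≤o M N (ℕₚ.m⊔n≤o⇒n≤o KL MN h)
      ≥N = λ {i} (h : KL ℕ.⊔ MN ℕ.≤ i) → ℕₚ.m⊔n≤o⇒n≤o M N (ℕₚ.m⊔n≤o⇒n≤o KL MN h)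
  in KL ℕ.⊔ MN , λ m n ≤m ≤n →
    triangle (seq x m ℚ.* (seq y m ℚ.- seq y n)) (seq y n ℚ.* (seq x m ℚ.- seq x n))
      (regroup (seq x m) (seq x n) (seq y m) (seq y n))
      (∣pq∣-bound (seq x m) (seq y m ℚ.- seq y n) 0<Bx Bxδy≡½ε
        (bx m (≥K ≤m)) (q m n (≥N ≤m) (≥N ≤n)))
      (∣pq∣-bound (seq y n) (seq x m ℚ.- seq x n) 0<By Byδx≡½ε
        (by n (≥L ≤n)) (p m n (≥M ≤m) (≥M ≤n)))
  where
  open +-*-Solver
  regroup : ∀ a b c d →
    a ℚ.* (c ℚ.- d) ℚ.+ d ℚ.* (a ℚ.- b) ≡ a ℚ.* c ℚ.- b ℚ.* d
  regroup = solve 4 (λ a b c d →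
    a :* (c :- d) :+ d :* (a :- b) := a :* c :- b :* d) refl

∑ : ∀ {n} → Vector ℝ n → ℝ
∑ = foldr _+_ 0ℝ

------------------------------------------------------------------------
-- Convex functions on [1,∞)

[1,∞[ : Setoid 0ℓ 0ℓ
[1,∞[ = record
  { Carrier       = Σ ℝ (1ℝ ≤_)
  ; _≈_           = λ x y → proj₁ x ≃ proj₁ y
  ; isEquivalence = On.isEquivalence proj₁ (Setoid.isEquivalence ≃-setoid)
  }

open Func public using () renaming (to to apply)

-- The point z stands for (1 - t) x + t y, which spares a proof that
-- [1,∞) is closed under convex combinations.
Convex : Func [1,∞[ ≃-setoid → Set
Convex f = ∀ (x y z : Setoid.Carrier [1,∞[) t → 0ℝ ≤ t → t ≤ 1ℝ →
  proj₁ z ≃ (1ℝ - t) * proj₁ x + t * proj₁ y →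
  apply f z ≤ (1ℝ - t) * apply f x + t * apply f y

StrictlyConvex : Func [1,∞[ ≃-setoid → Set
StrictlyConvex f = ∀ (x y z : Setoid.Carrier [1,∞[) t →
  proj₁ x # proj₁ y → 0ℝ < t → t < 1ℝ →
  proj₁ z ≃ (1ℝ - t) * proj₁ x + t * proj₁ y →
  apply f z < (1ℝ - t) * apply f x + t * apply f y

natural : ∀ d → 1 ℕ.≤ d → Setoid.Carrier [1,∞[
natural d 1≤d = fromℕ d , λ ε 0<ε → 0 , λ _ _ → begin-strict
  1ℚ                   ≡⟨ sym (ℚₚ.+-identityʳ 1ℚ) ⟩
  1ℚ ℚ.+ 0ℚ            <⟨ ℚₚ.+-mono-≤-< 1≤d/1 0<ε ⟩
  (+ d ℚ./ 1) ℚ.+ ε    ∎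
  where
  open ℚₚ.≤-Reasoning
  1≤d/1 : 1ℚ ℚ.≤ + d ℚ./ 1
  1≤d/1 = ℚₚ.toℚᵘ-cancel-≤ (ℚᵘₚ.≤-respʳ-≃
    (ℚᵘₚ.≃-sym (ℚₚ.toℚᵘ-fromℚᵘ (ℚᵘ.mkℚᵘ (+ d) 0)))
    (ℚᵘ.*≤* (ℤₚ.*-monoʳ-≤-nonNeg (+ 1) (ℤ.+≤+ 1≤d))))

------------------------------------------------------------------------
-- Graphs

record SimpleGraph (V : Set) : Set₁ where
  infix 4 _∼_
  field
    _∼_      : Rel V 0ℓ
    ∼-sym    : Symmetric _∼_
    ∼-irrefl : ∀ {v} → ¬ v ∼ v

record Isomorphism {V W : Set} (G : SimpleGraph V) (H : SimpleGraph W) : Set where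
  private
    module G = SimpleGraph G
    module H = SimpleGraph H
  field
    bijection : V ↔ W
    adjacency : ∀ u v → (u G.∼ v) ⇔ (Inverse.to bijection u H.∼ Inverse.to bijection v)

-- The standing assumptions (finite, connected, simple, at least one edge)
-- are bundled; decidability of adjacency makes degrees computable and is
-- automatic classically.
record Graph (n : ℕ) : Set₁ where
  field
    simpleGraph : SimpleGraph (Fin n)
  open SimpleGraph simpleGraph public
  field
    _∼?_      : Decidable _∼_
    connected : ∀ u v → Star _∼_ u v
    edge      : ∃₂ _∼_
open Graph public using (simpleGraph)

degree : ∀ {n} → Graph n → Fin n → ℕ
degree G u = count (u ∼?_) (allFin _)
  where open Graph G

MaximumDegree : ∀ {n} → Graph n → ℕ → Set
MaximumDegree G Δ = (∀ u → degree G u ℕ.≤ Δ) × ∃[ u ] degree G u ≡ Δ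

private
  count-pos : ∀ {A : Set} {P : U.Pred A 0ℓ} (P? : U.Decidable P) {n} (xs : Vec A n) i →
              P (lookup xs i) → 1 ℕ.≤ count P? xs
  count-pos P? (x ∷ xs) i h with P? x
  count-pos P? (x ∷ xs) i           h | yes _ = s≤s z≤n
  count-pos P? (x ∷ xs) Fin.zero    h | no ¬p = contradiction h ¬p
  count-pos P? (x ∷ xs) (Fin.suc i) h | no _  = count-pos P? xs i h

degree≥1 : ∀ {n} (G : Graph n) u → 1 ℕ.≤ degree G u
degree≥1 G u = count-pos (u ∼?_) (allFin _) (proj₁ neighbour)
  (subst (u ∼_) (sym (lookup-allFin _)) (proj₂ neighbour))
  where
  open Graph G
  neighbour : ∃ (u ∼_)
  neighbour with edge
  ... | a , b , a∼b with connected u a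
  ... | nil     = b , a∼b
  ... | u∼v ◅ _ = _ , u∼v

I : Func [1,∞[ ≃-setoid → ∀ {n} → Graph n → ℝ
I f G = ∑ λ u → apply f (natural (degree G u) (degree≥1 G u))

------------------------------------------------------------------------
-- Cycles

-- j ≡ i + 1 modulo k
Next : ∀ {k} → Rel (Fin k) 0ℓ
Next {k} i j = toℕ j ≡ suc (toℕ i) ⊎ (suc (toℕ i) ≡ k × toℕ j ≡ 0)

record Cycle {V : Set} (G : SimpleGraph V) : Set where
  open SimpleGraph G
  field
    length    : ℕ
    length≥3  : 3 ℕ.≤ length
    vertex    : Fin length → V
    injective : Injective _≡_ _≡_ vertex
    adjacent  : ∀ {i j} → Next i j → vertex i ∼ vertex j

  Edge : Rel V 0ℓ
  Edge u v = ∃₂ λ i j → SymClosure Next i j × vertex i ≡ u × vertex j ≡ v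

-- Cycles are counted as subgraphs: two parametrisations with the same
-- edges (differing by rotation and reflection) are one cycle.
SameCycle : ∀ {V} {G : SimpleGraph V} → Rel (Cycle G) 0ℓ
SameCycle C D = ∀ u v → Cycle.Edge C u v ⇔ Cycle.Edge D u v

Unicyclic : ∀ {n} → Graph n → Set
Unicyclic G = ∃[ C ] ∀ (D : Cycle (simpleGraph G)) → SameCycle D C

------------------------------------------------------------------------
-- The class ℋ_n^Δ

-- The j-th path runs from the cycle vertex c through the m j new
-- vertices (onPath j a), a = 0, …, m j - 1, and so has length m j.
module _ {k p : ℕ} (c : Fin k) (m : Fin p → ℕ) where

  data Vertex : Set where
    onCycle : Fin k → Vertex
    onPath  : (j : Fin p) → Fin (m j) → Vertex

  data Link : Rel Vertex 0ℓ where
    around : ∀ {i i′} → Next i i′ → Link (onCycle i) (onCycle i′)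
    attach : ∀ {j a} → toℕ a ≡ 0 → Link (onCycle c) (onPath j a)
    along  : ∀ {j a a′} → toℕ a′ ≡ suc (toℕ a) → Link (onPath j a) (onPath j a′)

  cycleWithPaths : 3 ℕ.≤ k → SimpleGraph Vertex
  cycleWithPaths k≥3 = record
    { _∼_      = SymClosure Link
    ; ∼-sym    = symmetric Link
    ; ∼-irrefl = λ { (fwd l) → irrefl l ; (bwd l) → irrefl l }
    }
    where
    irrefl : ∀ {v} → ¬ Link v v
    irrefl (around (inj₁ i≡1+i))       = ℕₚ.1+n≢n (sym i≡1+i)
    irrefl (around (inj₂ (1+i≡k , i≡0))) =
      ℕₚ.<⇒≢ (ℕₚ.≤-trans (s≤s (s≤s z≤n)) k≥3) (trans (cong suc (sym i≡0)) 1+i≡k)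
    irrefl (along a≡1+a)               = ℕₚ.1+n≢n (sym a≡1+a)

infix 4 _∈ℋ_

record _∈ℋ_ {n} (G : Graph n) (Δ : ℕ) : Set where
  field
    k    : ℕ
    k≥3  : 3 ℕ.≤ k
    k≤   : k ℕ.≤ n ℕ.∸ Δ ℕ.+ 2
    m    : Fin (Δ ℕ.∸ 2) → ℕ
    m≥1  : ∀ j → 1 ℕ.≤ m j
    size : k ℕ.+ sum m ≡ n
    c    : Fin k
    iso  : Isomorphism (simpleGraph G) (cycleWithPaths c m k≥3)

------------------------------------------------------------------------

lowerBound : Func [1,∞[ ≃-setoid → ℕ → ∀ Δ → 1 ℕ.≤ Δ → ℝ
lowerBound f n Δ 1≤Δ =
    apply f (natural Δ 1≤Δ)
  + (fromℕ n - fromℕ Δ + 1ℝ) * apply f (natural 2 (s≤s z≤n))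
  + (fromℕ Δ - fromℕ 2) * apply f (natural 1 (s≤s z≤n))

{-# OPTIONS --safe #-}

-- Convexity bounds f (d) from below by the secant of f through 1 and 2,
-- with equality at d = 1, 2 and, for strictly convex f, only there.
-- Applying this to every vertex except one vertex w of degree Δ, and using
-- that the degrees add up to 2 n, yields the bound; equality means that all
-- vertices other than w have degree at most 2.
--
-- Both the degree sum and the shape of the extremal graphs come from an
-- orientation of G: s moves each vertex of the cycle C to its successor on C
-- and each other vertex to a neighbour nearer to C.  Every edge joins some v
-- to s v, for otherwise following s from both of its ends gives a
-- non-backtracking walk that starts on C, leaves it along an edge outside C
-- and never stops, and such a walk closes up a second cycle.  So edges
-- correspond to vertices.  If moreover only w has degree above 2, then w lies
-- on C, and off C the map s is injective except above w, so that the rest of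
-- G consists of disjoint paths descending to w.

module Submission where

open import Defs
import Algebra.Properties.CommutativeMonoid.Sum
open import Data.Bool using (if_then_else_)
open import Data.Empty using (⊥; ⊥-elim)
open import Data.Fin using (Fin; toℕ; fromℕ<; inject₁; punchIn; punchOut; _≟_)
  renaming (zero to fzero; suc to fsuc; fromℕ to maximum)
open import Data.Fin.Permutation using (↔⇒≡)
import Data.Fin.Properties as Finₚ
open import Data.Integer as ℤ using (+_)
import Data.Integer.Properties as ℤₚ
open import Data.Nat as ℕ using (ℕ; zero; suc; z≤n; s≤s; _∸_)
open import Data.Nat.Properties using (m+n≤o⇒m≤o)
import Data.Nat.Properties as ℕₚ
open import Data.Product using (Σ; ∃; ∃₂; ∃-syntax; _×_; _,_; proj₁; proj₂)
open import Data.Rational as ℚ using (ℚ; 0ℚ; 1ℚ)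
import Data.Rational.Properties as ℚₚ
open import Data.Rational.Solver using (module +-*-Solver)
import Data.Rational.Unnormalised as ℚᵘ
import Data.Rational.Unnormalised.Properties as ℚᵘₚ
open import Data.Sum using (_⊎_; inj₁; inj₂; [_,_]′)
open import Data.Sum.Function.Propositional using (_⊎-↔_)
open import Data.Vec using (count; tabulate)
open import Data.Vec.Functional using (removeAt)
open import Function using (_∘_; id)
open import Function.Bundles using (Func; _↔_; _⇔_; Injection; Inverse; Equivalence; mk⇔; mk↔ₛ′; mk⤖)
open import Function.Consequences.Propositional using (strictlySurjective⇒surjective)
open import Function.Definitions using (Injective)
open import Function.Properties.Bijection using (⤖⇒↔)
open import Function.Properties.Inverse using (↔⇒↣; ↔-refl; ↔-sym; ↔-trans)
open import Level using (0ℓ)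
open import Relation.Binary.Construct.Closure.ReflexiveTransitive
  using (Star; _◅_) renaming (ε to nil)
open import Relation.Binary.Construct.Closure.Symmetric using (SymClosure; fwd; bwd; symmetric)
open import Relation.Binary.Definitions using (tri<; tri≈; tri>)
open import Relation.Binary.PropositionalEquality
open import Relation.Nullary using (¬_; Dec; yes; no; does; contradiction)
open import Relation.Nullary.Decidable using (_×-dec_; ¬?; decidable-stable)
open import Relation.Unary as U using (Pred)

module ℕ∑ = Algebra.Properties.CommutativeMonoid.Sum ℕₚ.+-0-commutativeMonoid
module ℚ∑ = Algebra.Properties.CommutativeMonoid.Sum ℚₚ.+-0-commutativeMonoid
open ℕ∑ using (sum)
open +-*-Solver using (solve; con; _:=_; _:+_; _:*_; _:-_)

-- Counting in finite sets

𝟙 : {A : Set} → Dec A → ℕ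
𝟙 a? = if does a? then 1 else 0

𝟙-cong : {A B : Set} (a? : Dec A) (b? : Dec B) → (A → B) → (B → A) → 𝟙 a? ≡ 𝟙 b?
𝟙-cong (yes a) (yes b) _ _ = refl
𝟙-cong (yes a) (no ¬b) f _ = contradiction (f a) ¬b
𝟙-cong (no ¬a) (yes b) _ g = contradiction (g b) ¬a
𝟙-cong (no ¬a) (no ¬b) _ _ = refl

𝟙-disjoint : {A B C : Set} (a? : Dec A) (b? : Dec B) (c? : Dec C) →
  (A → B ⊎ C) → (B ⊎ C → A) → (B → ¬ C) → 𝟙 a? ≡ 𝟙 b? ℕ.+ 𝟙 c?
𝟙-disjoint a? b? c? f g ¬bc with b? | c?
... | yes b | yes c = contradiction c (¬bc b)
... | yes b | no _  = 𝟙-cong a? (yes b) (λ _ → b) (λ _ → g (inj₁ b))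
... | no _  | yes c = 𝟙-cong a? (yes c) (λ _ → c) (λ _ → g (inj₂ c))
... | no ¬b | no ¬c with a?
...   | yes a = contradiction (f a) [ ¬b , ¬c ]′
...   | no _  = refl

# : ∀ {n} {P : Pred (Fin n) 0ℓ} → U.Decidable P → ℕ
# P? = sum (𝟙 ∘ P?)

count-tabulate : ∀ {A : Set} {P : Pred A 0ℓ} (P? : U.Decidable P) {n} (g : Fin n → A) →
  count P? (tabulate g) ≡ # (P? ∘ g)
count-tabulate P? {zero}  g = refl
count-tabulate P? {suc n} g with P? (g fzero)
... | yes _ = cong suc (count-tabulate P? (g ∘ fsuc))
... | no _  = count-tabulate P? (g ∘ fsuc)

-- As a sum of indicators, the degree can be split and double counted.
degree≡# : ∀ {n} (G : Graph n) u → degree G u ≡ # (Graph._∼?_ G u)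
degree≡# G u = count-tabulate (Graph._∼?_ G u) id

#-singleton : ∀ {n} (a : Fin n) → # (_≟ a) ≡ 1
#-singleton {suc n} fzero    = cong suc (ℕ∑.sum-replicate-zero n)
#-singleton {suc n} (fsuc a) = #-singleton a

-- Makes a count usable: in pigeonhole arguments below, and to index the paths hanging from `w`.
record Enumeration {n} (P : Pred (Fin n) 0ℓ) (p : ℕ) : Set where
  field
    elem       : Fin p → Fin n
    injective  : Injective _≡_ _≡_ elem
    sound      : ∀ j → P (elem j)
    complete   : ∀ {v} → P v → ∃[ j ] elem j ≡ v

enumerate : ∀ {n} {P : Pred (Fin n) 0ℓ} (P? : U.Decidable P) → Enumeration P (# P?)
enumerate {zero}      P? = record
  { elem = λ () ; injective = λ { {()} } ; sound = λ () ; complete = λ { {()} } }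
enumerate {suc n} {P} P? with P? fzero | enumerate (P? ∘ fsuc)
... | no ¬p0 | E = record
  { elem      = fsuc ∘ E.elem
  ; injective = E.injective ∘ Finₚ.suc-injective
  ; sound     = E.sound
  ; complete  = λ { {fzero} p → contradiction p ¬p0
                  ; {fsuc v} p → let j , q = E.complete p in j , cong fsuc q }
  }
  where module E = Enumeration E
... | yes p0 | E = record
  { elem      = el
  ; injective = λ { {fzero} {fzero} _ → refl
                  ; {fsuc _} {fsuc _} q → cong fsuc (E.injective (Finₚ.suc-injective q)) }
  ; sound     = λ { fzero → p0 ; (fsuc j) → E.sound j }
  ; complete  = λ { {fzero} _ → fzero , refl
                  ; {fsuc v} p → let j , q = E.complete p in fsuc j , cong fsuc q }
  }
  where
  module E = Enumeration E
  el : Fin (suc (# (P? ∘ fsuc))) → Fin (suc n)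
  el fzero    = fzero
  el (fsuc j) = fsuc (E.elem j)

-- Pigeonhole: of three distinct elements two fall into the same class, and a class has at most one
-- element.
#≤2 : ∀ {n} {P A B : Pred (Fin n) 0ℓ} (P? : U.Decidable P) →
  (∀ {v} → P v → A v ⊎ B v) →
  (∀ {v v′} → A v → A v′ → v ≡ v′) → (∀ {v v′} → B v → B v′ → v ≡ v′) → # P? ℕ.≤ 2
#≤2 {P = P} {A} {B} P? split A-unique B-unique with # P? | enumerate P?
... | 0 | _ = z≤n
... | 1 | _ = s≤s z≤n
... | 2 | _ = s≤s (s≤s z≤n)
... | suc (suc (suc _)) | E = ⊥-elim (three (split (E.sound _)) (split (E.sound _)) (split (E.sound _)))
  where
  module E = Enumeration E
  absurd : ∀ {i j} → E.elem i ≡ E.elem j → i ≢ j → ⊥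
  absurd q i≢j = i≢j (E.injective q)
  e₀ = E.elem fzero
  e₁ = E.elem (fsuc fzero)
  e₂ = E.elem (fsuc (fsuc fzero))
  three : A e₀ ⊎ B e₀ → A e₁ ⊎ B e₁ → A e₂ ⊎ B e₂ → ⊥
  three (inj₁ a) (inj₁ b) _        = absurd (A-unique a b) λ ()
  three (inj₁ a) _        (inj₁ c) = absurd (A-unique a c) λ ()
  three _        (inj₁ b) (inj₁ c) = absurd (A-unique b c) λ ()
  three (inj₂ a) (inj₂ b) _        = absurd (B-unique a b) λ ()
  three (inj₂ a) _        (inj₂ c) = absurd (B-unique a c) λ ()
  three _        (inj₂ b) (inj₂ c) = absurd (B-unique b c) λ ()

3≤# : ∀ {n} {P : Pred (Fin n) 0ℓ} (P? : U.Decidable P) {a b c : Fin n} →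
  P a → P b → P c → a ≢ b → a ≢ c → b ≢ c → 3 ℕ.≤ # P?
3≤# P? {a} {b} {c} Pa Pb Pc a≢b a≢c b≢c = Finₚ.injective⇒≤ {f = index} index-injective
  where
  open Enumeration (enumerate P?)
  index : Fin 3 → Fin (# P?)
  index fzero               = proj₁ (complete Pa)
  index (fsuc fzero)        = proj₁ (complete Pb)
  index (fsuc (fsuc fzero)) = proj₁ (complete Pc)
  point : Fin 3 → _
  point fzero               = a
  point (fsuc fzero)        = b
  point (fsuc (fsuc fzero)) = c
  elem-index : ∀ i → elem (index i) ≡ point i
  elem-index fzero               = proj₂ (complete Pa)
  elem-index (fsuc fzero)        = proj₂ (complete Pb)
  elem-index (fsuc (fsuc fzero)) = proj₂ (complete Pc)
  point-injective : ∀ i j → point i ≡ point j → i ≡ j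
  point-injective fzero fzero _ = refl
  point-injective fzero (fsuc fzero) q = contradiction q a≢b
  point-injective fzero (fsuc (fsuc fzero)) q = contradiction q a≢c
  point-injective (fsuc fzero) fzero q = contradiction (sym q) a≢b
  point-injective (fsuc fzero) (fsuc fzero) _ = refl
  point-injective (fsuc fzero) (fsuc (fsuc fzero)) q = contradiction q b≢c
  point-injective (fsuc (fsuc fzero)) fzero q = contradiction (sym q) a≢c
  point-injective (fsuc (fsuc fzero)) (fsuc fzero) q = contradiction (sym q) b≢c
  point-injective (fsuc (fsuc fzero)) (fsuc (fsuc fzero)) _ = refl
  index-injective : Injective _≡_ _≡_ index
  index-injective {i} {j} q =
    point-injective i j (trans (sym (elem-index i)) (trans (cong elem q) (elem-index j)))

-- Provides the distance to the cycle, the first repetition on a walk and the lengths of the paths.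
least : ∀ {P : Pred ℕ 0ℓ} → U.Decidable P → ∀ i → P i →
  ∃[ m ] P m × (∀ {j} → j ℕ.< m → ¬ P j)
least P? zero    p = 0 , p , λ ()
least P? (suc i) p with P? 0
... | yes p₀ = 0 , p₀ , λ ()
... | no ¬p₀ with least (P? ∘ suc) i p
...   | m , q , min = suc m , q , λ { {zero} _ → ¬p₀ ; {suc _} (s≤s l) → min l }

-- The cyclic order on `Fin k`

next : ∀ {k} (i : Fin k) → ∃ (Next i)
next {k} i with suc (toℕ i) ℕ.<? k
... | yes 1+i<k = fromℕ< 1+i<k , inj₁ (Finₚ.toℕ-fromℕ< 1+i<k)
... | no ¬1+i<k = fromℕ< 0<k , inj₂ (ℕₚ.≤-antisym (Finₚ.toℕ<n i) (ℕₚ.≮⇒≥ ¬1+i<k) , Finₚ.toℕ-fromℕ< 0<k)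
  where
  0<k : 0 ℕ.< k
  0<k = ℕₚ.≤-<-trans z≤n (Finₚ.toℕ<n i)

Next-functional : ∀ {k} {i j j′ : Fin k} → Next i j → Next i j′ → j ≡ j′
Next-functional (inj₁ p)       (inj₁ q)       = Finₚ.toℕ-injective (trans p (sym q))
Next-functional {j = j} (inj₁ p) (inj₂ (q , _)) =
  contradiction (trans p q) (ℕₚ.<⇒≢ (Finₚ.toℕ<n j))
Next-functional {j′ = j′} (inj₂ (p , _)) (inj₁ q) =
  contradiction (trans q p) (ℕₚ.<⇒≢ (Finₚ.toℕ<n j′))
Next-functional (inj₂ (_ , p)) (inj₂ (_ , q)) = Finₚ.toℕ-injective (trans p (sym q))

Next-injective : ∀ {k} {i i′ j : Fin k} → Next i j → Next i′ j → i ≡ i′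
Next-injective (inj₁ p)       (inj₁ q)       =
  Finₚ.toℕ-injective (ℕₚ.suc-injective (trans (sym p) q))
Next-injective (inj₁ p)       (inj₂ (_ , q)) = contradiction (trans (sym p) q) λ ()
Next-injective (inj₂ (_ , p)) (inj₁ q)       = contradiction (trans (sym q) p) λ ()
Next-injective (inj₂ (p , _)) (inj₂ (q , _)) =
  Finₚ.toℕ-injective (ℕₚ.suc-injective (trans p (sym q)))

-- Fails for `k = 2`. This is what stops `s` from oscillating between two cycle vertices.
Next-asym : ∀ {k} {i j : Fin k} → 3 ℕ.≤ k → Next i j → ¬ Next j i
Next-asym 3≤k (inj₁ p) (inj₁ q) = ℕₚ.m≢1+n+m _ (trans q (cong suc p))
Next-asym 3≤k (inj₁ p) (inj₂ (q , r)) rewrite p | r = ℕₚ.<⇒≢ 3≤k q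
Next-asym 3≤k (inj₂ (p , q)) (inj₁ r) rewrite r | q = ℕₚ.<⇒≢ 3≤k p
Next-asym 3≤k (inj₂ (p , q)) (inj₂ (r , s)) rewrite s = ℕₚ.<⇒≢ (ℕₚ.≤-trans (s≤s (s≤s z≤n)) 3≤k) p

-- The orientation of a unicyclic graph towards its cycle

module Orientation {n} (G : Graph n) (C : Cycle (simpleGraph G))
                   (unique : ∀ D → SameCycle D C) where
  open Graph G hiding (simpleGraph)
  open Cycle C using (vertex; Edge) renaming
    (length to k; length≥3 to 3≤k; injective to vertex-injective; adjacent to vertex-adjacent)

  OnC : Pred (Fin n) 0ℓ
  OnC v = ∃[ i ] vertex i ≡ v

  onC? : U.Decidable OnC
  onC? v = Finₚ.any? λ i → vertex i ≟ v

  -- Repeated vertices are allowed: for fixed `l` the predicate is decidable by search, and the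
  -- least `l` is the distance to C.
  WalkToC : ℕ → Pred (Fin n) 0ℓ
  WalkToC zero    v = OnC v
  WalkToC (suc l) v = ∃[ u ] v ∼ u × WalkToC l u

  walkToC? : ∀ l → U.Decidable (WalkToC l)
  walkToC? zero    v = onC? v
  walkToC? (suc l) v = Finₚ.any? λ u → (v ∼? u) ×-dec walkToC? l u

  walkToC : ∀ {u v} → Star _∼_ u v → OnC v → ∃[ l ] WalkToC l u
  walkToC nil       v∈C = 0 , v∈C
  walkToC (u∼w ◅ p) v∈C = let l , q = walkToC p v∈C in suc l , _ , u∼w , q

  distance : ∀ v → ∃[ l ] WalkToC l v × (∀ {j} → j ℕ.< l → ¬ WalkToC j v)
  distance v = let l , p = walkToC (connected v (vertex i₀)) (i₀ , refl)
               in least (λ l → walkToC? l v) l p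
    where i₀ = fromℕ< (ℕₚ.≤-trans (s≤s z≤n) 3≤k)

  dist : Fin n → ℕ
  dist v = proj₁ (distance v)

  Towards : Fin n → Fin n → Set
  Towards v u = (∃₂ λ i j → Next i j × vertex i ≡ v × vertex j ≡ u)
              ⊎ (¬ OnC v × dist u ℕ.< dist v)

  abstract
    -- Off C, take the first step of a shortest walk to C: the rest of that walk, of length `l`,
    -- bounds the distance of `u`.
    successor : ∀ v → ∃[ u ] v ∼ u × Towards v u
    successor v with onC? v
    ... | yes (i , refl) = let j , i→j = next i in
          vertex j , vertex-adjacent i→j , inj₁ (i , j , i→j , refl , refl)
    ... | no v∉C with distance v
    ...   | zero  , v∈C , _         = contradiction v∈C v∉C
    ...   | suc l , (u , v∼u , p) , _ = u , v∼u , inj₂ (v∉C , s≤s (ℕₚ.≮⇒≥ λ l<d →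
              proj₂ (proj₂ (distance u)) l<d p))

  s : Fin n → Fin n
  s v = proj₁ (successor v)

  s-adjacent : ∀ v → v ∼ s v
  s-adjacent v = proj₁ (proj₂ (successor v))

  s-towards : ∀ v → Towards v (s v)
  s-towards v = proj₂ (proj₂ (successor v))

  s-next : ∀ {i j} → Next i j → s (vertex i) ≡ vertex j
  s-next {i} {j} i→j with s-towards (vertex i)
  ... | inj₂ (∉C , _) = contradiction (i , refl) ∉C
  ... | inj₁ (i′ , j′ , i′→j′ , p , q) with refl ← vertex-injective p =
        trans (sym q) (cong vertex (Next-functional i′→j′ i→j))

  -- On C this is `Next-asym`; off C distances strictly decrease, and `s` never leaves C. Hence
  -- orbits of `s` do not backtrack.
  s∘s≢ : ∀ v → s (s v) ≢ v
  s∘s≢ v ssv≡v with s-towards v | s-towards (s v)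
  ... | inj₁ (i , j , i→j , p , q) | inj₁ (i′ , j′ , i′→j′ , p′ , q′)
        with refl ← vertex-injective (trans q (sym p′))
           | refl ← vertex-injective (trans (trans q′ ssv≡v) (sym p)) = Next-asym 3≤k i→j i′→j′
  ... | inj₁ (_ , j , _ , _ , q)   | inj₂ (∉C , _) = ∉C (j , q)
  ... | inj₂ (∉C , _) | inj₁ (_ , j′ , _ , _ , q′) = ∉C (j′ , trans q′ ssv≡v)
  ... | inj₂ (_ , d)  | inj₂ (_ , d′) = ℕₚ.<-asym d (subst (ℕ._< dist (s v)) (cong dist ssv≡v) d′)

  s-onC : ∀ {v} → OnC v → OnC (s v)
  s-onC (i , refl) = let j , i→j = next i in j , sym (s-next i→j)

  s^ : ℕ → Fin n → Fin n
  s^ zero    v = v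
  s^ (suc a) v = s^ a (s v)

  s^-suc : ∀ a v → s^ (suc a) v ≡ s (s^ a v)
  s^-suc zero    v = refl
  s^-suc (suc a) v = s^-suc a (s v)

  s^-onC : ∀ a {v} → OnC v → OnC (s^ a v)
  s^-onC zero    v∈C = v∈C
  s^-onC (suc a) v∈C = s^-onC a (s-onC v∈C)

  abstract
    -- Each step off C lowers the distance, so the recursion runs on a bound `d` for it.
    reachesC : ∀ v → ∃[ a ] OnC (s^ a v)
    reachesC v = go (dist v) v ℕₚ.≤-refl
      where
      go : ∀ d v → dist v ℕ.≤ d → ∃[ a ] OnC (s^ a v)
      go d v v≤d with s-towards v
      go d       v v≤d | inj₁ (i , _ , _ , p , _) = 0 , i , p
      go zero    v v≤d | inj₂ (_ , sv<v) = contradiction (ℕₚ.<-≤-trans sv<v v≤d) λ ()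
      go (suc d) v v≤d | inj₂ (_ , sv<v) =
        let a , p = go d (s v) (ℕₚ.≤-pred (ℕₚ.<-≤-trans sv<v v≤d)) in suc a , p

  -- The walk is infinite, so that in a finite graph it must revisit a vertex.
  record NonBacktracking : Set where
    field
      at    : ℕ → Fin n
      steps : ∀ i → at i ∼ at (suc i)
      turns : ∀ i → at (suc (suc i)) ≢ at i

  -- The first repetition on the walk closes up a cycle; it is not C, since
  -- it either contains the first edge or misses the starting point.
  leave-C-by-non-C-edge : (W : NonBacktracking) → let open NonBacktracking W in
    OnC (at 0) → ¬ Edge (at 0) (at 1) → ⊥
  leave-C-by-non-C-edge W (i₀ , start) ¬edge
    with x , y , x<y , px≡py ← Finₚ.pigeonhole (ℕₚ.n<1+n n) (NonBacktracking.at W ∘ toℕ)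
    -- `j` is the first time at which an earlier vertex recurs, so all vertices before time `j` are
    -- distinct.
    with j , (i , ati≡atj) , first ← least (λ j → Finₚ.any? λ (i : Fin j) →
                 NonBacktracking.at W (toℕ i) ≟ NonBacktracking.at W j)
               (toℕ y) (fromℕ< x<y , trans (cong (NonBacktracking.at W) (Finₚ.toℕ-fromℕ< x<y)) px≡py)
    = close (toℕ i) (j ∸ toℕ i)
        (trans ati≡atj (cong at (sym (j≡ i))))
        (ℕₚ.m<n⇒0<n∸m (Finₚ.toℕ<n i))
        λ b<c c<j → distinct b<c (subst (_ ℕ.<_) (j≡ i) c<j)
    where
    open NonBacktracking W

    j≡ : ∀ {j} (i : Fin j) → j ∸ toℕ i ℕ.+ toℕ i ≡ j
    j≡ i = ℕₚ.m∸n+n≡m (ℕₚ.<⇒≤ (Finₚ.toℕ<n i))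

    distinct : ∀ {b c} → b ℕ.< c → c ℕ.< j → at b ≢ at c
    distinct b<c c<j q = first c<j (fromℕ< b<c , trans (cong at (Finₚ.toℕ-fromℕ< b<c)) q)

    close : ∀ a l → at a ≡ at (l ℕ.+ a) → 0 ℕ.< l →
            (∀ {b c} → b ℕ.< c → c ℕ.< l ℕ.+ a → at b ≢ at c) → ⊥
    -- A return after one step would be a loop, after two steps a backtrack.
    close a 1 closed _ _ = ∼-irrefl (subst (_∼ at (suc a)) closed (steps a))
    close a 2 closed _ _ = turns a (sym closed)
    close a l@(suc (suc (suc _))) closed _ distinct = elsewhere a refl
      where
      D : Cycle (simpleGraph G)
      D = record
        { length    = l
        ; length≥3  = s≤s (s≤s (s≤s z≤n))
        ; vertex    = λ t → at (toℕ t ℕ.+ a)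
        ; injective = λ {t} {t′} → inj t t′
        ; adjacent  = adj
        }
        where
        inj : ∀ (t t′ : Fin l) → at (toℕ t ℕ.+ a) ≡ at (toℕ t′ ℕ.+ a) → t ≡ t′
        inj t t′ q with ℕₚ.<-cmp (toℕ t) (toℕ t′)
        ... | tri≈ _ t≡t′ _ = Finₚ.toℕ-injective t≡t′
        ... | tri< t<t′ _ _ = contradiction q
              (distinct (ℕₚ.+-monoˡ-< a t<t′) (ℕₚ.+-monoˡ-< a (Finₚ.toℕ<n t′)))
        ... | tri> _ _ t′<t = contradiction (sym q)
              (distinct (ℕₚ.+-monoˡ-< a t′<t) (ℕₚ.+-monoˡ-< a (Finₚ.toℕ<n t)))
        adj : ∀ {t t′ : Fin l} → Next t t′ → at (toℕ t ℕ.+ a) ∼ at (toℕ t′ ℕ.+ a)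
        adj {t} {t′} (inj₁ q) rewrite q = steps (toℕ t ℕ.+ a)
        adj {t} {t′} (inj₂ (q , r)) rewrite r | closed =
          subst (λ m → at (toℕ t ℕ.+ a) ∼ at (m ℕ.+ a)) q (steps (toℕ t ℕ.+ a))

      elsewhere : ∀ a′ → a ≡ a′ → ⊥
      elsewhere zero     refl = ¬edge (Equivalence.to (unique D _ _)
        (fzero , fsuc fzero , fwd (inj₁ refl) , refl , refl))
      -- `at 0` is an end of an edge of C, so it would lie on `D`; but the vertices of `D` are
      -- visited at times after 0 and before the first repetition.
      elsewhere (suc a′) refl
        with t , _ , _ , q , _ ← Equivalence.from (unique D _ _)
               (i₀ , proj₁ (next i₀) , fwd (proj₂ (next i₀)) , start , refl)
        = distinct (ℕₚ.≤-trans (s≤s z≤n) (ℕₚ.m≤n+m (suc a′) (toℕ t)))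
            (ℕₚ.+-monoˡ-< a (Finₚ.toℕ<n t)) (sym q)

  -- Walking backwards from C to the start of W along s reduces this to the
  -- previous lemma.
  leave-against-s : ∀ a (W : NonBacktracking) → let open NonBacktracking W in
    OnC (s^ a (at 0)) → ¬ Edge (at 0) (at 1) → at 1 ≢ s (at 0) → ⊥
  leave-against-s zero    W ∈C ¬edge _ = leave-C-by-non-C-edge W ∈C ¬edge
  leave-against-s (suc a) W ∈C ¬edge against with onC? (NonBacktracking.at W 0)
  ... | yes start∈C = leave-C-by-non-C-edge W start∈C ¬edge
  -- The prepended edge from `s (at 0)` to `at 0` has an end off C, so it is not on C, and it runs
  -- against `s` by `s∘s≢`.
  ... | no start∉C  = leave-against-s a W′ ∈C
        (λ (_ , j , _ , _ , q) → start∉C (j , q)) (s∘s≢ (at 0) ∘ sym)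
    where
    open NonBacktracking W
    W′ : NonBacktracking
    W′ = record
      { at    = λ { zero → s (at 0) ; (suc i) → at i }
      ; steps = λ { zero → ∼-sym (s-adjacent (at 0)) ; (suc i) → steps i }
      ; turns = λ { zero → against ; (suc i) → turns i }
      }

  C-edge⇒s : ∀ {u v} → Edge u v → v ≡ s u ⊎ s v ≡ u
  C-edge⇒s (_ , _ , fwd i→j , refl , refl) = inj₁ (sym (s-next i→j))
  C-edge⇒s (_ , _ , bwd j→i , refl , refl) = inj₂ (s-next j→i)

  -- Otherwise `u`, `v`, `s v`, `s (s v)`, ... is a non-backtracking walk whose first edge is not on
  -- C, as edges of C do follow `s`; this contradicts `leave-against-s`.
  ∼⇒s : ∀ {u v} → u ∼ v → v ≡ s u ⊎ s v ≡ u
  ∼⇒s {u} {v} u∼v with v ≟ s u | s v ≟ u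
  ... | yes p | _     = inj₁ p
  ... | no _  | yes q = inj₂ q
  ... | no ¬p | no ¬q =
    let a , ∈C = reachesC u in ⊥-elim (leave-against-s a W ∈C ([ ¬p , ¬q ]′ ∘ C-edge⇒s) ¬p)
    where
    W : NonBacktracking
    W = record
      { at    = λ { zero → u ; (suc i) → s^ i v }
      ; steps = λ { zero → u∼v ; (suc i) → subst (s^ i v ∼_) (sym (s^-suc i v)) (s-adjacent (s^ i v)) }
      ; turns = λ { zero → ¬q
                  ; (suc i) q → s∘s≢ (s^ i v) (trans (sym (trans (s^-suc (suc i) v) (cong s (s^-suc i v)))) q)
                  }
      }

  s⇒∼ : ∀ {u v} → v ≡ s u ⊎ s v ≡ u → u ∼ v
  s⇒∼ (inj₁ refl) = s-adjacent _
  s⇒∼ (inj₂ refl) = ∼-sym (s-adjacent _)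

  -- The neighbours of `u` are `s u` and the preimages of `u` under `s`; by `s∘s≢` these do not
  -- overlap.
  degree≡ : ∀ u → degree G u ≡ 1 ℕ.+ # (λ v → s v ≟ u)
  degree≡ u = begin
    degree G u                                    ≡⟨ degree≡# G u ⟩
    # (u ∼?_)                                     ≡⟨ ℕ∑.sum-cong-≗ split ⟩
    sum (λ v → 𝟙 (v ≟ s u) ℕ.+ 𝟙 (s v ≟ u))       ≡⟨ ℕ∑.∑-distrib-+ (𝟙 ∘ (_≟ s u)) (λ v → 𝟙 (s v ≟ u)) ⟩
    # (_≟ s u) ℕ.+ # (λ v → s v ≟ u)              ≡⟨ cong (ℕ._+ # (λ v → s v ≟ u)) (#-singleton (s u)) ⟩
    1 ℕ.+ # (λ v → s v ≟ u)                       ∎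
    where
    open ≡-Reasoning
    split : ∀ v → 𝟙 (u ∼? v) ≡ 𝟙 (v ≟ s u) ℕ.+ 𝟙 (s v ≟ u)
    split v = 𝟙-disjoint (u ∼? v) (v ≟ s u) (s v ≟ u) ∼⇒s s⇒∼ λ { refl → s∘s≢ u }

  -- After exchanging the sums, each `v` is counted once, at its only image `s v`.
  ∑degree≡n+n : sum (degree G) ≡ n ℕ.+ n
  ∑degree≡n+n = begin
    sum (degree G)                                  ≡⟨ ℕ∑.sum-cong-≗ degree≡ ⟩
    sum (λ u → 1 ℕ.+ # (λ v → s v ≟ u))             ≡⟨ ℕ∑.∑-distrib-+ {n} (λ _ → 1) (λ u → # (λ v → s v ≟ u)) ⟩
    ones ℕ.+ sum (λ u → sum λ v → 𝟙 (s v ≟ u))      ≡⟨ cong (ones ℕ.+_) (ℕ∑.∑-comm (λ u v → 𝟙 (s v ≟ u))) ⟩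
    ones ℕ.+ sum (λ v → sum λ u → 𝟙 (s v ≟ u))      ≡⟨ cong (ones ℕ.+_) (ℕ∑.sum-cong-≗ ∑ₛ) ⟩
    ones ℕ.+ ones                                   ≡⟨ cong₂ ℕ._+_ (∑1 n) (∑1 n) ⟩
    n ℕ.+ n                                         ∎
    where
    open ≡-Reasoning
    ones = sum {n} (λ _ → 1)
    ∑ₛ : ∀ v → sum (λ u → 𝟙 (s v ≟ u)) ≡ 1
    ∑ₛ v = trans (ℕ∑.sum-cong-≗ λ u → 𝟙-cong (s v ≟ u) (u ≟ s v) sym sym) (#-singleton (s v))
    ∑1 : ∀ n → sum {n} (λ _ → 1) ≡ n
    ∑1 zero    = refl
    ∑1 (suc n) = cong suc (∑1 n)

-- Characterisation of the class ℋ

sum-upper : ∀ {n} (t : Fin n → ℕ) i → t i ℕ.≤ sum t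
sum-upper t fzero    = ℕₚ.m≤m+n (t fzero) _
sum-upper t (fsuc i) = ℕₚ.≤-trans (sum-upper (t ∘ fsuc) i) (ℕₚ.m≤n+m _ (t fzero))

≤-sum : ∀ {n} (t : Fin n → ℕ) → (∀ i → 1 ℕ.≤ t i) → n ℕ.≤ sum t
≤-sum {zero}  t 1≤t = z≤n
≤-sum {suc n} t 1≤t = ℕₚ.+-mono-≤ (1≤t fzero) (≤-sum (t ∘ fsuc) (1≤t ∘ fsuc))

Σ-Fin↔Fin-sum : ∀ {p} (m : Fin p → ℕ) → Σ (Fin p) (Fin ∘ m) ↔ Fin (sum m)
Σ-Fin↔Fin-sum {zero}  m = mk↔ₛ′ (λ ()) (λ ()) (λ ()) (λ ())
Σ-Fin↔Fin-sum {suc p} m =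
  ↔-trans head⊎tail (↔-trans (↔-refl ⊎-↔ Σ-Fin↔Fin-sum (m ∘ fsuc)) (↔-sym Finₚ.+↔⊎))
  where
  head⊎tail : Σ (Fin (suc p)) (Fin ∘ m) ↔ (Fin (m fzero) ⊎ Σ (Fin p) (Fin ∘ m ∘ fsuc))
  head⊎tail = mk↔ₛ′
    (λ { (fzero , a) → inj₁ a ; (fsuc j , a) → inj₂ (j , a) })
    (λ { (inj₁ a) → fzero , a ; (inj₂ (j , a)) → fsuc j , a })
    (λ { (inj₁ _) → refl ; (inj₂ _) → refl })
    (λ { (fzero , _) → refl ; (fsuc _ , _) → refl })

previous : ∀ {k} (j : Fin k) → ∃[ i ] Next i j
previous {suc k} fzero    = maximum k , inj₂ (cong suc (Finₚ.toℕ-fromℕ k) , refl)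
previous {suc k} (fsuc j) = inject₁ j , inj₁ (cong suc (sym (Finₚ.toℕ-inject₁ j)))

module _ {k p} {c : Fin k} {m : Fin p → ℕ} where

  -- Serves to compare the number of vertices of the model with `n`.
  Vertex↔Fin : Vertex c m ↔ Fin (k ℕ.+ sum m)
  Vertex↔Fin =
    ↔-trans cycle⊎paths (↔-trans (↔-refl ⊎-↔ Σ-Fin↔Fin-sum m) (↔-sym Finₚ.+↔⊎))
    where
    cycle⊎paths : Vertex c m ↔ (Fin k ⊎ Σ (Fin p) (Fin ∘ m))
    cycle⊎paths = mk↔ₛ′
      (λ { (onCycle i) → inj₁ i ; (onPath j a) → inj₂ (j , a) })
      (λ { (inj₁ i) → onCycle i ; (inj₂ (j , a)) → onPath j a })
      (λ { (inj₁ _) → refl ; (inj₂ _) → refl })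
      (λ { (onCycle _) → refl ; (onPath _ _) → refl })

  -- Only at `onCycle c` can links branch. With `Link-injective` this leaves any other vertex at
  -- most one outgoing and one incoming link.
  Link-functional : ∀ {x y y′ : Vertex c m} → x ≢ onCycle c → Link c m x y → Link c m x y′ → y ≡ y′
  Link-functional x≢c (around p) (around q) = cong onCycle (Next-functional p q)
  Link-functional x≢c (attach _) _          = contradiction refl x≢c
  Link-functional x≢c _          (attach _) = contradiction refl x≢c
  Link-functional x≢c (along p)  (along q)  =
    cong (onPath _) (Finₚ.toℕ-injective (trans p (sym q)))

  Link-injective : ∀ {x y y′ : Vertex c m} → Link c m y x → Link c m y′ x → y ≡ y′
  Link-injective (around p) (around q) = cong onCycle (Next-injective p q)
  Link-injective (attach _) (attach _) = refl
  Link-injective (attach p) (along q)  = contradiction (trans (sym q) p) λ ()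
  Link-injective (along p)  (attach q) = contradiction (trans (sym p) q) λ ()
  Link-injective (along p)  (along q)  =
    cong (onPath _) (Finₚ.toℕ-injective (ℕₚ.suc-injective (trans (sym p) q)))

  ≟onCycle-c : (x : Vertex c m) → Dec (x ≡ onCycle c)
  ≟onCycle-c (onPath _ _) = no λ ()
  ≟onCycle-c (onCycle i) with i ≟ c
  ... | yes refl = yes refl
  ... | no i≢c   = no λ { refl → i≢c refl }

-- Only the vertex mapped to `onCycle c` can have degree above 2, so it must be `w`.
ℋ⇒degree≤2 : ∀ {n Δ} (G : Graph n) → G ∈ℋ Δ → ∀ {w} → 3 ℕ.≤ degree G w →
  ∀ v → v ≢ w → degree G v ℕ.≤ 2
ℋ⇒degree≤2 G G∈ℋ {w} 3≤w v v≢w = degree≤2 v λ v↦c →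
  v≢w (to-injective (trans v↦c (sym w↦c)))
  where
  open _∈ℋ_ G∈ℋ
  open Isomorphism iso
  open Inverse bijection using (to)
  to-injective : Injective _≡_ _≡_ to
  to-injective = Injection.injective (↔⇒↣ bijection)
  degree≤2 : ∀ u → to u ≢ onCycle c → degree G u ℕ.≤ 2
  degree≤2 u u↦̸c = subst (ℕ._≤ 2) (sym (degree≡# G u)) (#≤2 (Graph._∼?_ G u) split
    (λ p q → to-injective (Link-functional u↦̸c p q))
    (λ p q → to-injective (Link-injective p q)))
    where
    split : ∀ {v} → Graph._∼_ G u v → Link c m (to u) (to v) ⊎ Link c m (to v) (to u)
    split u∼v with Equivalence.to (adjacency _ _) u∼v
    ... | fwd l = inj₁ l
    ... | bwd l = inj₂ l
  w↦c : to w ≡ onCycle c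
  w↦c with ≟onCycle-c (to w)
  ... | yes q = q
  ... | no ¬q = contradiction (ℕₚ.≤-trans 3≤w (degree≤2 w ¬q)) λ { (s≤s (s≤s ())) }

-- Decomposition into the cycle and paths when only `w` branches

module Decomposition {n Δ} (G : Graph n) (C : Cycle (simpleGraph G))
  (unique : ∀ D → SameCycle D C) (3≤Δ : 3 ℕ.≤ Δ) {w} (deg-w : degree G w ≡ Δ)
  (degree≤2 : ∀ v → v ≢ w → degree G v ℕ.≤ 2) where

  open Graph G hiding (simpleGraph)
  open Orientation G C unique
  open Cycle C using (vertex) renaming
    (length to k; length≥3 to 3≤k; injective to vertex-injective; adjacent to vertex-adjacent)

  -- Two different preimages together with `s v` would give `v` three neighbours.
  s-injective-at : ∀ {v x y} → v ≢ w → s x ≡ v → s y ≡ v → x ≡ y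
  s-injective-at {v} {x} {y} v≢w sx≡v sy≡v with x ≟ y
  ... | yes x≡y = x≡y
  ... | no x≢y  = contradiction
    (ℕₚ.≤-trans
      (3≤# (v ∼?_) (s-adjacent v) (s⇒∼ (inj₂ sx≡v)) (s⇒∼ (inj₂ sy≡v)) (sv≢ sx≡v) (sv≢ sy≡v) x≢y)
      (subst (ℕ._≤ 2) (degree≡# G v) (degree≤2 v v≢w)))
    λ { (s≤s (s≤s ())) }
    where
    sv≢ : ∀ {x} → s x ≡ v → s v ≢ x
    sv≢ sx≡v refl = s∘s≢ v sx≡v

  -- A vertex of C already has its predecessor on C as a preimage, so a second one is possible only
  -- at `w`.
  enter-C-at-w : ∀ {v} → ¬ OnC v → OnC (s v) → s v ≡ w
  enter-C-at-w {v} v∉C (i , i≡) with s v ≟ w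
  ... | yes p = p
  ... | no ¬p = let j , j→i = previous i in
        contradiction (j , s-injective-at ¬p (trans (s-next j→i) i≡) refl) v∉C

  -- Take the last vertex of the orbit before it enters C.
  descend : ∀ a v → ¬ OnC v → OnC (s^ a v) → ∃[ b ] ¬ OnC (s^ b v) × s (s^ b v) ≡ w
  descend zero    v v∉C ∈C = contradiction ∈C v∉C
  descend (suc a) v v∉C ∈C with onC? (s v)
  ... | yes sv∈C = 0 , v∉C , enter-C-at-w v∉C sv∈C
  ... | no sv∉C  = let b , p = descend a (s v) sv∉C ∈C in suc b , p

  abstract
    -- Were `w` off C, its orbit would still enter C, and the point of entry is `w`.
    w∈C : OnC w
    w∈C with onC? w
    ... | yes p = p
    ... | no w∉C with reachesC w
    ...   | a , ∈C = go a w w∉C ∈C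
      where
      go : ∀ a v → ¬ OnC v → OnC (s^ a v) → OnC w
      go zero    v v∉C ∈C = contradiction ∈C v∉C
      go (suc a) v v∉C ∈C with onC? (s v)
      ... | yes sv∈C = subst OnC (enter-C-at-w v∉C sv∈C) sv∈C
      ... | no sv∉C  = go a (s v) sv∉C ∈C

  c : Fin k
  c = proj₁ w∈C

  vertex-c : vertex c ≡ w
  vertex-c = proj₂ w∈C

  -- These are the first vertices of the paths attached at `w`.
  Root : Pred (Fin n) 0ℓ
  Root v = s v ≡ w × ¬ OnC v

  root? : U.Decidable Root
  root? v = (s v ≟ w) ×-dec ¬? (onC? v)

  -- Two of the `Δ` neighbours of `w` lie on C, namely `s w` and the predecessor `w⁻`; the rest are
  -- roots.
  #roots : # root? ≡ Δ ∸ 2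
  #roots = sym (begin
    Δ ∸ 2                                       ≡⟨ cong (_∸ 2) (trans (sym deg-w) (degree≡ w)) ⟩
    # (λ v → s v ≟ w) ∸ 1                       ≡⟨ cong (_∸ 1) (ℕ∑.sum-cong-≗ split) ⟩
    sum (λ v → 𝟙 (v ≟ w⁻) ℕ.+ 𝟙 (root? v)) ∸ 1  ≡⟨ cong (_∸ 1) (ℕ∑.∑-distrib-+ (𝟙 ∘ (_≟ w⁻)) (𝟙 ∘ root?)) ⟩
    # (_≟ w⁻) ℕ.+ # root? ∸ 1                   ≡⟨ cong (λ h → h ℕ.+ # root? ∸ 1) (#-singleton w⁻) ⟩
    # root?                                     ∎)
    where
    open ≡-Reasoning
    w⁻ = vertex (proj₁ (previous c))
    s-w⁻ : s w⁻ ≡ w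
    s-w⁻ = trans (s-next (proj₂ (previous c))) vertex-c
    split : ∀ v → 𝟙 (s v ≟ w) ≡ 𝟙 (v ≟ w⁻) ℕ.+ 𝟙 (root? v)
    split v = 𝟙-disjoint (s v ≟ w) (v ≟ w⁻) (root? v) to from λ { refl (_ , ∉C) → ∉C (_ , refl) }
      where
      to : s v ≡ w → v ≡ w⁻ ⊎ Root v
      to sv≡w with onC? v
      ... | no v∉C = inj₂ (sv≡w , v∉C)
      ... | yes (i , refl) = inj₁ (cong vertex
        (Next-injective (subst (Next i) i⁺≡c i→i⁺) (proj₂ (previous c))))
        where
        i→i⁺ = proj₂ (next i)
        i⁺≡c = vertex-injective (trans (sym (s-next i→i⁺)) (trans sv≡w (sym vertex-c)))
      from : v ≡ w⁻ ⊎ Root v → s v ≡ w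
      from (inj₁ refl)       = s-w⁻
      from (inj₂ (sv≡w , _)) = sv≡w

  abstract
    roots : Enumeration Root (Δ ∸ 2)
    roots = subst (Enumeration Root) #roots (enumerate root?)

  open Enumeration roots using () renaming
    (elem to root; injective to root-injective; sound to root-sound; complete to root-complete)

  -- The j-th path consists of the solutions v of s^ a v ≡ root j, with a as
  -- the position on the path.
  At : Fin (Δ ∸ 2) → ℕ → Fin n → Set
  At j a v = s^ a v ≡ root j

  s^-+ : ∀ a b v → s^ (a ℕ.+ b) v ≡ s^ b (s^ a v)
  s^-+ zero    b v = refl
  s^-+ (suc a) b v = s^-+ a b (s v)

  At⇒∉C : ∀ {j a v} → At j a v → ¬ OnC v
  At⇒∉C {j} {a} p v∈C = proj₂ (root-sound j) (subst OnC p (s^-onC a v∈C))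

  -- Going back from the root, every vertex is off C and so differs from `w`; hence each has at most
  -- one preimage.
  At-unique : ∀ {j a v v′} → At j a v → At j a v′ → v ≡ v′
  At-unique {j} {a} p q = go a (proj₂ (root-sound j)) p q
    where
    go : ∀ a {x v v′} → ¬ OnC x → s^ a v ≡ x → s^ a v′ ≡ x → v ≡ v′
    go zero    x∉C p q = trans p (sym q)
    go (suc a) {x} {v} {v′} x∉C p q = go a
      (λ ∈C → x∉C (subst OnC (trans (sym (s^-suc a v)) p) (s-onC ∈C)))
      refl
      (s-injective-at (λ { refl → x∉C w∈C })
        (trans (sym (s^-suc a v′)) q) (trans (sym (s^-suc a v)) p))

  -- One step after a root the orbit is at `w` and from then on stays on C, so it meets no further
  -- root.
  At-≮ : ∀ {i j a b v} → At i a v → At j b v → ¬ (a ℕ.< b)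
  At-≮ {i} {j} {a} {b} {v} p q a<b = proj₂ (root-sound j) (subst OnC eq (s^-onC (b ∸ suc a) w∈C))
    where
    open ≡-Reasoning
    eq : s^ (b ∸ suc a) w ≡ root j
    eq = begin
      s^ (b ∸ suc a) w                 ≡⟨ cong (s^ (b ∸ suc a)) (sym (trans (s^-suc a v)
                                            (trans (cong s p) (proj₁ (root-sound i))))) ⟩
      s^ (b ∸ suc a) (s^ (suc a) v)    ≡⟨ sym (s^-+ (suc a) (b ∸ suc a) v) ⟩
      s^ (suc a ℕ.+ (b ∸ suc a)) v     ≡⟨ cong (λ h → s^ h v) (ℕₚ.m+[n∸m]≡n a<b) ⟩
      s^ b v                           ≡⟨ q ⟩
      root j                           ∎

  At-coordinates : ∀ {i j a b v} → At i a v → At j b v → i ≡ j × a ≡ b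
  At-coordinates {a = a} {b} p q with ℕₚ.<-cmp a b
  ... | tri< a<b _ _ = contradiction a<b (At-≮ p q)
  ... | tri> _ _ b<a = contradiction b<a (At-≮ q p)
  ... | tri≈ _ refl _ = root-injective (trans (sym p) q) , refl

  at? : ∀ j a → Dec (∃ (At j a))
  at? j a = Finₚ.any? λ v → s^ a v ≟ root j

  abstract
    -- The length is the first unoccupied position. One exists: `N` bounds the time every vertex
    -- takes to reach C, where there are no roots.
    path-end : ∀ j → ∃[ m ] ¬ ∃ (At j m) × (∀ {a} → a ℕ.< m → ¬ ¬ ∃ (At j a))
    path-end j = least (¬? ∘ at? j) N λ (v , p) → proj₂ (root-sound j) (subst OnC p (by-N v))
      where
      N : ℕ
      N = sum (proj₁ ∘ reachesC)
      by-N : ∀ v → OnC (s^ N v)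
      by-N v = let a , ∈C = reachesC v in subst OnC
        (trans (sym (s^-+ a (N ∸ a) v))
          (cong (λ h → s^ h v) (ℕₚ.m+[n∸m]≡n (sum-upper (proj₁ ∘ reachesC) v))))
        (s^-onC (N ∸ a) ∈C)

  m : Fin (Δ ∸ 2) → ℕ
  m j = proj₁ (path-end j)

  m≥1 : ∀ j → 1 ℕ.≤ m j
  m≥1 j with m j | proj₁ (proj₂ (path-end j))
  ... | zero  | ¬at₀ = contradiction (root j , refl) ¬at₀
  ... | suc _ | _    = s≤s z≤n

  -- A vertex further out would have an iterate at the unoccupied position `m j`.
  At-< : ∀ {j a v} → At j a v → a ℕ.< m j
  At-< {j} {a} {v} p = ℕₚ.≰⇒> λ m≤a → proj₁ (proj₂ (path-end j))
    (s^ (a ∸ m j) v , trans (sym (s^-+ (a ∸ m j) (m j) v))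
      (trans (cong (λ h → s^ h v) (ℕₚ.m∸n+n≡m m≤a)) p))

  abstract
    path : ∀ j (a : Fin (m j)) → ∃ (At j (toℕ a))
    path j a = decidable-stable (at? j (toℕ a)) (proj₂ (proj₂ (path-end j)) (Finₚ.toℕ<n a))

  φ : Vertex c m → Fin n
  φ (onCycle i)  = vertex i
  φ (onPath j a) = proj₁ (path j a)

  φ-injective : Injective _≡_ _≡_ φ
  φ-injective {onCycle i}  {onCycle i′}  q = cong onCycle (vertex-injective q)
  φ-injective {onCycle i}  {onPath j a}  q = contradiction (i , q) (At⇒∉C {j} {toℕ a} (proj₂ (path j a)))
  φ-injective {onPath j a} {onCycle i}   q = contradiction (i , sym q) (At⇒∉C {j} {toℕ a} (proj₂ (path j a)))
  φ-injective {onPath j a} {onPath j′ a′} q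
    with At-coordinates {j} {j′} {toℕ a} {toℕ a′} (proj₂ (path j a))
           (subst (At j′ (toℕ a′)) (sym q) (proj₂ (path j′ a′)))
  ... | refl , r = cong (onPath j) (Finₚ.toℕ-injective r)

  φ-surjective : ∀ v → ∃[ x ] φ x ≡ v
  φ-surjective v with onC? v
  ... | yes (i , i≡v) = onCycle i , i≡v
  ... | no v∉C =
    -- The orbit of `v` meets a root just before `w`; the number `b` of steps to it is the position
    -- of `v`.
    let a , ∈C = reachesC v
        b , ∉C , sb≡w = descend a v v∉C ∈C
        j , rj≡ = root-complete (sb≡w , ∉C)
        at-b = sym rj≡
        b<m = At-< {j} {b} {v} at-b
    in onPath j (fromℕ< b<m) ,
       At-unique {j} {b} (subst (λ h → At j h (proj₁ (path j (fromℕ< b<m)))) (Finₚ.toℕ-fromℕ< b<m)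
                   (proj₂ (path j (fromℕ< b<m)))) at-b

  s-along : ∀ {j a a′} → toℕ a′ ≡ suc (toℕ a) → s (φ (onPath j a′)) ≡ φ (onPath j a)
  s-along {j} {a} {a′} q = At-unique {j} {toℕ a}
    (subst (λ h → At j h (φ (onPath j a′))) q (proj₂ (path j a′))) (proj₂ (path j a))

  s-attach : ∀ {j a} → toℕ a ≡ 0 → s (φ (onPath j a)) ≡ w
  s-attach {j} {a} q =
    trans (cong s (subst (λ h → At j h (φ (onPath j a))) q (proj₂ (path j a)))) (proj₁ (root-sound j))

  -- Since every edge of `G` joins some `v` to `s v`, this suffices to find every edge of `G` in the
  -- model.
  s-φ : ∀ x → ∃[ y ] SymClosure (Link c m) x y × φ y ≡ s (φ x)
  s-φ (onCycle i) = let i′ , i→i′ = next i in onCycle i′ , fwd (around i→i′) , sym (s-next i→i′)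
  s-φ (onPath j a) = go (toℕ a) refl
    where
    go : ∀ h → toℕ a ≡ h → ∃[ y ] SymClosure (Link c m) (onPath j a) y × φ y ≡ s (φ (onPath j a))
    go zero    eq = onCycle c , bwd (attach eq) , trans vertex-c (sym (s-attach eq))
    go (suc h) eq = onPath j b , bwd (along a≡) , sym (s-along a≡)
      where
      h<m : h ℕ.< m j
      h<m = ℕₚ.<-trans (ℕₚ.n<1+n h) (subst (ℕ._< m j) eq (Finₚ.toℕ<n a))
      b = fromℕ< h<m
      a≡ : toℕ a ≡ suc (toℕ b)
      a≡ = trans eq (cong suc (sym (Finₚ.toℕ-fromℕ< h<m)))

  Link⇒∼ : ∀ {x y} → Link c m x y → φ x ∼ φ y
  Link⇒∼ (around i→i′) = vertex-adjacent i→i′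
  Link⇒∼ (attach q)    = s⇒∼ (inj₂ (trans (s-attach q) (sym vertex-c)))
  Link⇒∼ (along q)     = s⇒∼ (inj₂ (s-along q))

  φ-adjacency : ∀ {x y} → φ x ∼ φ y ⇔ SymClosure (Link c m) x y
  φ-adjacency {x} {y} = mk⇔ to λ { (fwd l) → Link⇒∼ l ; (bwd l) → ∼-sym (Link⇒∼ l) }
    where
    to : ∀ {x y} → φ x ∼ φ y → SymClosure (Link c m) x y
    to {x} {y} x∼y with ∼⇒s x∼y | s-φ x | s-φ y
    ... | inj₁ q | z , l , r | _ =
          subst (SymClosure (Link c m) x) (φ-injective (trans r (sym q))) l
    ... | inj₂ q | _ | z , l , r =
          symmetric (Link c m) (subst (SymClosure (Link c m) y) (φ-injective (trans r q)) l)

  φ-inverse : Fin n ↔ Vertex c m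
  φ-inverse = ↔-sym (⤖⇒↔ (mk⤖ (φ-injective , strictlySurjective⇒surjective φ-surjective)))

  size : k ℕ.+ sum m ≡ n
  size = sym (↔⇒≡ (↔-trans φ-inverse Vertex↔Fin))

  -- The `Δ ∸ 2` paths take up at least one vertex each.
  k≤ : k ℕ.≤ n ∸ Δ ℕ.+ 2
  k≤ = begin
    k                        ≡⟨ sym (ℕₚ.m+n∸n≡m k (Δ ∸ 2)) ⟩
    k ℕ.+ (Δ ∸ 2) ∸ (Δ ∸ 2)  ≤⟨ ℕₚ.∸-monoˡ-≤ (Δ ∸ 2) (ℕₚ.≤-trans
                                  (ℕₚ.+-monoʳ-≤ k (≤-sum m m≥1)) (ℕₚ.≤-reflexive size)) ⟩
    n ∸ (Δ ∸ 2)              ≤⟨ ℕₚ.m≤n+m∸n _ 2 ⟩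
    2 ℕ.+ (n ∸ (Δ ∸ 2) ∸ 2)  ≡⟨ cong (2 ℕ.+_) (trans (ℕₚ.∸-+-assoc n (Δ ∸ 2) 2)
                                  (cong (n ∸_) (ℕₚ.m∸n+n≡m (ℕₚ.≤-trans (s≤s (s≤s z≤n)) 3≤Δ)))) ⟩
    2 ℕ.+ (n ∸ Δ)            ≡⟨ ℕₚ.+-comm 2 _ ⟩
    n ∸ Δ ℕ.+ 2              ∎
    where open ℕₚ.≤-Reasoning

  G∈ℋ : G ∈ℋ Δ
  G∈ℋ = record
    { k = k ; k≥3 = 3≤k ; k≤ = k≤ ; m = m ; m≥1 = m≥1 ; size = size ; c = c
    ; iso = record
      { bijection = φ-inverse
      ; adjacency = λ u v → subst₂ (λ u′ v′ → u′ ∼ v′ ⇔ SymClosure (Link c m) (to u) (to v))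
          (strictlyInverseʳ u) (strictlyInverseʳ v) (φ-adjacency {to u} {to v})
      }
    }
    where open Inverse φ-inverse using (to; strictlyInverseʳ)

-- Rational and real inequalities

ι : ℕ → ℚ
ι m = + m ℚ./ 1

ι-+ : ∀ m n → ι (m ℕ.+ n) ≡ ι m ℚ.+ ι n
ι-+ m n = ℚₚ.toℚᵘ-injective (begin
  ℚ.toℚᵘ (ι (m ℕ.+ n))                 ≈⟨ toℚᵘ-ι (m ℕ.+ n) ⟩
  (m ℕ.+ n) /1                          ≈⟨ ℚᵘ.*≡* (cong (ℤ._* + 1) (cong₂ ℤ._+_
                                             (sym (ℤₚ.*-identityʳ (+ m))) (sym (ℤₚ.*-identityʳ (+ n))))) ⟩
  m /1 ℚᵘ.+ n /1                     ≈⟨ ℚᵘₚ.+-cong (toℚᵘ-ι m) (toℚᵘ-ι n) ⟨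
  ℚ.toℚᵘ (ι m) ℚᵘ.+ ℚ.toℚᵘ (ι n)       ≈⟨ ℚₚ.toℚᵘ-homo-+ (ι m) (ι n) ⟨
  ℚ.toℚᵘ (ι m ℚ.+ ι n)                 ∎)
  where
  open ℚᵘₚ.≃-Reasoning
  _/1 : ℕ → ℚᵘ.ℚᵘ
  m /1 = ℚᵘ.mkℚᵘ (+ m) 0
  toℚᵘ-ι : ∀ m → ℚ.toℚᵘ (ι m) ℚᵘ.≃ m /1
  toℚᵘ-ι m = ℚₚ.toℚᵘ-fromℚᵘ (m /1)

0<ι : ∀ m → 0ℚ ℚ.< ι (suc m)
0<ι m = ℚₚ.positive⁻¹ (ι (suc m)) {{ℚₚ.normalize-pos (suc m) 1}}

-- Reduces the rearrangement of an inequality to a ring identity for the solver.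
<-shift : ∀ {a b c d} → b ℚ.- a ≡ d ℚ.- c → a ℚ.< b → c ℚ.< d
<-shift {a} {b} {c} {d} eq a<b = subst₂ ℚ._<_
  (solve 2 (λ a c → a :+ (c :- a) := c) refl a c)
  (trans (solve 3 (λ a b c → b :+ (c :- a) := (b :- a) :+ c) refl a b c)
    (trans (cong (ℚ._+ c) eq) (solve 2 (λ c d → (d :- c) :+ c := d) refl c d)))
  (ℚₚ.+-monoˡ-< (c ℚ.- a) a<b)

0<* : ∀ {p q} → 0ℚ ℚ.< p → 0ℚ ℚ.< q → 0ℚ ℚ.< p ℚ.* q
0<* {p} {q} 0<p 0<q =
  ℚₚ.positive⁻¹ _ {{ℚₚ.pos*pos⇒pos p {{ℚ.positive 0<p}} q {{ℚ.positive 0<q}}}}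

reciprocal : ∀ {q} → 0ℚ ℚ.< q → ∃[ t ] 0ℚ ℚ.< t × q ℚ.* t ≡ 1ℚ
reciprocal {q} 0<q =
  ℚ.1/ q , ℚₚ.positive⁻¹ _ {{ℚₚ.1/pos⇒pos q}} , ℚₚ.*-inverseʳ q
  where instance
    q-pos : ℚ.Positive q
    q-pos = ℚ.positive 0<q
    q-nonZero : ℚ.NonZero q
    q-nonZero = ℚₚ.pos⇒nonZero q

divide : ∀ {q ε} → 0ℚ ℚ.< q → 0ℚ ℚ.< ε → ∃[ δ ] 0ℚ ℚ.< δ × q ℚ.* δ ≡ ε
divide {q} {ε} 0<q 0<ε = let t , 0<t , qt≡1 = reciprocal 0<q in
  t ℚ.* ε , 0<* 0<t 0<ε ,
  trans (sym (ℚₚ.*-assoc q t ε)) (trans (cong (ℚ._* ε) qt≡1) (ℚₚ.*-identityˡ ε))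

halve : ∀ {ε} → 0ℚ ℚ.< ε → ∃[ δ ] 0ℚ ℚ.< δ × δ ℚ.+ δ ≡ ε
halve 0<ε = let δ , 0<δ , 2δ≡ε = divide (0<ι 1) 0<ε in
  δ , 0<δ , trans (solve 1 (λ δ → δ :+ δ := con (ι 2) :* δ) refl δ) 2δ≡ε

_⊓_ : ∀ {P Q : ℕ → Set} → Eventually P → Eventually Q → Eventually (λ k → P k × Q k)
(M , p) ⊓ (N , q) = M ℕ.⊔ N , λ k ≤k →
  p k (ℕₚ.m⊔n≤o⇒m≤o M N ≤k) , q k (ℕₚ.m⊔n≤o⇒n≤o M N ≤k)

eventually-map : ∀ {P Q : ℕ → Set} → (∀ k → P k → Q k) → Eventually P → Eventually Q
eventually-map h (N , p) = N , λ k ≤k → h k (p k ≤k)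

fromℚ-mono-< : ∀ {p q} → p ℚ.< q → fromℚ p < fromℚ q
fromℚ-mono-< {p} {q} p<q =
  let δ , 0<δ , 2δ≡q-p = halve {q ℚ.- p}
        (<-shift (solve 2 (λ p q → q :- p := (q :- p) :- con 0ℚ) refl p q) p<q)
  in δ , 0<δ , 0 , λ _ _ → <-shift
    (trans (solve 1 (λ δ → δ :- con 0ℚ := (δ :+ δ) :- δ) refl δ)
      (trans (cong (ℚ._- δ) 2δ≡q-p) (solve 3 (λ p q δ → (q :- p) :- δ := q :- (p :+ δ)) refl p q δ)))
    0<δ

<⇒≤ : ∀ {x y} → x < y → x ≤ y
<⇒≤ {x} {y} (η , 0<η , ev) ε 0<ε = eventually-map (λ k x+η<y → ℚₚ.<-trans
    (<-shift (solve 2 (λ η x → η :- con 0ℚ := (x :+ η) :- x) refl η (seq x k)) 0<η)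
    (ℚₚ.<-trans x+η<y (<-shift (solve 2 (λ ε y → ε :- con 0ℚ := (y :+ ε) :- y) refl ε (seq y k)) 0<ε))) ev

≗⇒≃ : ∀ {x y} → (∀ k → seq x k ≡ seq y k) → x ≃ y
≗⇒≃ {x} {y} eq ε 0<ε = 0 , λ k _ → subst (ℚ._< ε)
  (cong ℚ.∣_∣ (sym (trans (cong (ℚ._- seq y k) (eq k)) (ℚₚ.+-inverseʳ (seq y k))))) 0<ε

0≤-zero : ∀ {x} → (∀ k → seq x k ≡ 0ℚ) → 0ℝ ≤ x
0≤-zero eq ε 0<ε = 0 , λ k _ → subst (0ℚ ℚ.<_)
  (sym (trans (cong (ℚ._+ ε) (eq k)) (ℚₚ.+-identityˡ ε))) 0<ε

0≤+ : ∀ {x y} → 0ℝ ≤ x → 0ℝ ≤ y → 0ℝ ≤ x + y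
0≤+ {x} {y} 0≤x 0≤y ε 0<ε = let δ , 0<δ , 2δ≡ε = halve 0<ε in
  eventually-map (λ k (p , q) → subst (λ ε → 0ℚ ℚ.< seq x k ℚ.+ seq y k ℚ.+ ε) 2δ≡ε
    (regroup (seq x k) (seq y k) δ p q))
  (0≤x δ 0<δ ⊓ 0≤y δ 0<δ)
  where
  regroup : ∀ x y δ → 0ℚ ℚ.< x ℚ.+ δ → 0ℚ ℚ.< y ℚ.+ δ → 0ℚ ℚ.< x ℚ.+ y ℚ.+ (δ ℚ.+ δ)
  regroup x y δ p q = subst (0ℚ ℚ.<_)
    (solve 3 (λ x y δ → (x :+ δ) :+ (y :+ δ) := x :+ y :+ (δ :+ δ)) refl x y δ)
    (ℚₚ.+-mono-< p q)

-- Half of the gap of `x` absorbs the error allowed to `y`; the other half remains as a gap.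
0<+ˡ : ∀ {x y} → 0ℝ < x → 0ℝ ≤ y → 0ℝ < x + y
0<+ˡ {x} {y} (ε , 0<ε , ev) 0≤y = let δ , 0<δ , 2δ≡ε = halve 0<ε in
  δ , 0<δ , eventually-map (λ k (p , q) → regroup (seq x k) (seq y k) δ
    (subst (λ ε → 0ℚ ℚ.+ ε ℚ.< seq x k) (sym 2δ≡ε) p) q)
  (ev ⊓ 0≤y δ 0<δ)
  where
  regroup : ∀ x y δ → 0ℚ ℚ.+ (δ ℚ.+ δ) ℚ.< x → 0ℚ ℚ.< y ℚ.+ δ → 0ℚ ℚ.+ δ ℚ.< x ℚ.+ y
  regroup x y δ p q = <-shift {0ℚ ℚ.+ (δ ℚ.+ δ) ℚ.+ 0ℚ} {x ℚ.+ (y ℚ.+ δ)}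
    (solve 3 (λ x y δ → (x :+ (y :+ δ)) :- ((con 0ℚ :+ (δ :+ δ)) :+ con 0ℚ) := (x :+ y) :- (con 0ℚ :+ δ))
      refl x y δ)
    (ℚₚ.+-mono-< p q)

0<+ʳ : ∀ {x y} → 0ℝ ≤ x → 0ℝ < y → 0ℝ < x + y
0<+ʳ {x} {y} 0≤x 0<y = let ε , 0<ε , ev = 0<+ˡ {y} {x} 0<y 0≤x in
  ε , 0<ε , eventually-map (λ k → subst (0ℚ ℚ.+ ε ℚ.<_) (ℚₚ.+-comm (seq y k) (seq x k))) ev

0≤∑ : ∀ {n} (g : Fin n → ℝ) → (∀ u → 0ℝ ≤ g u) → 0ℝ ≤ ∑ g
0≤∑ {zero}  g 0≤g = 0≤-zero {0ℝ} λ _ → refl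
0≤∑ {suc n} g 0≤g = 0≤+ {g fzero} {∑ (g ∘ fsuc)} (0≤g fzero) (0≤∑ (g ∘ fsuc) (0≤g ∘ fsuc))

0<∑ : ∀ {n} (g : Fin n → ℝ) → (∀ u → 0ℝ ≤ g u) → ∀ u → 0ℝ < g u → 0ℝ < ∑ g
0<∑ g 0≤g fzero    0<gu = 0<+ˡ {g fzero} {∑ (g ∘ fsuc)} 0<gu (0≤∑ (g ∘ fsuc) (0≤g ∘ fsuc))
0<∑ g 0≤g (fsuc u) 0<gu = 0<+ʳ {g fzero} {∑ (g ∘ fsuc)} (0≤g fzero) (0<∑ (g ∘ fsuc) (0≤g ∘ fsuc) u 0<gu)

seq-∑ : ∀ {n} (g : Fin n → ℝ) k → seq (∑ g) k ≡ ℚ∑.sum λ u → seq (g u) k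
seq-∑ {zero}  g k = refl
seq-∑ {suc n} g k = cong (seq (g fzero) k ℚ.+_) (seq-∑ (g ∘ fsuc) k)

-- The relation is asked for term by term: real arithmetic acts termwise, so such identities are
-- rational ones.
scale-≤ : ∀ {x y z q} → 0ℚ ℚ.< q → (∀ k → seq z k ≡ q ℚ.* (seq y k ℚ.- seq x k)) → x ≤ y → 0ℝ ≤ z
scale-≤ {x} {y} {z} {q} 0<q eq x≤y ε 0<ε = let δ , 0<δ , qδ≡ε = divide 0<q 0<ε in
  eventually-map (λ k p → subst (0ℚ ℚ.<_) (cong₂ ℚ._+_ (sym (eq k)) qδ≡ε)
    (scale (seq x k) (seq y k) δ p))
  (x≤y δ 0<δ)
  where
  scale : ∀ x y δ → x ℚ.< y ℚ.+ δ → 0ℚ ℚ.< q ℚ.* (y ℚ.- x) ℚ.+ q ℚ.* δ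
  scale x y δ p = subst (0ℚ ℚ.<_)
    (solve 4 (λ q x y δ → q :* ((y :+ δ) :- x) := q :* (y :- x) :+ q :* δ) refl q x y δ)
    (0<* 0<q (<-shift {x} {y ℚ.+ δ}
      (solve 3 (λ x y δ → (y :+ δ) :- x := ((y :+ δ) :- x) :- con 0ℚ) refl x y δ) p))

scale-< : ∀ {x y z q} → 0ℚ ℚ.< q → (∀ k → seq z k ≡ q ℚ.* (seq y k ℚ.- seq x k)) → x < y → 0ℝ < z
scale-< {x} {y} {z} {q} 0<q eq (ε , 0<ε , ev) = q ℚ.* ε , 0<* 0<q 0<ε ,
  eventually-map (λ k p → subst (0ℚ ℚ.+ q ℚ.* ε ℚ.<_) (sym (eq k)) (scale (seq x k) (seq y k) p)) ev
  where
  scale : ∀ x y → x ℚ.+ ε ℚ.< y → 0ℚ ℚ.+ q ℚ.* ε ℚ.< q ℚ.* (y ℚ.- x)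
  scale x y p = <-shift {0ℚ} {q ℚ.* (y ℚ.- (x ℚ.+ ε))}
    (solve 4 (λ q x y ε → q :* (y :- (x :+ ε)) :- con 0ℚ := q :* (y :- x) :- (con 0ℚ :+ q :* ε))
      refl q x y ε)
    (0<* 0<q (<-shift {x ℚ.+ ε} {y}
      (solve 3 (λ x y ε → y :- (x :+ ε) := (y :- (x :+ ε)) :- con 0ℚ) refl x y ε) p))

module _ {x y d : ℝ} (y≡x+d : ∀ k → seq y k ≡ seq x k ℚ.+ seq d k) where

  0≤difference⇒≤ : 0ℝ ≤ d → x ≤ y
  0≤difference⇒≤ 0≤d ε 0<ε = eventually-map (λ k p →
    subst (λ h → seq x k ℚ.< h ℚ.+ ε) (sym (y≡x+d k)) (shift (seq x k) (seq d k) p)) (0≤d ε 0<ε)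
    where
    shift : ∀ x d → 0ℚ ℚ.< d ℚ.+ ε → x ℚ.< x ℚ.+ d ℚ.+ ε
    shift x d = <-shift {0ℚ} {d ℚ.+ ε}
      (solve 3 (λ x d ε → (d :+ ε) :- con 0ℚ := (x :+ d) :+ ε :- x) refl x d ε)

  zero-difference⇒≃ : (∀ k → seq d k ≡ 0ℚ) → y ≃ x
  zero-difference⇒≃ d≡0 = ≗⇒≃ {y} {x} λ k →
    trans (y≡x+d k) (trans (cong (seq x k ℚ.+_) (d≡0 k)) (ℚₚ.+-identityʳ (seq x k)))

  -- The gap `ε` of `d` contradicts `y ≃ x` at tolerance `ε`.
  0<difference⇒≄ : 0ℝ < d → ¬ y ≃ x
  0<difference⇒≄ (ε , 0<ε , ev) y≃x =
    let N , p = ev ⊓ y≃x ε 0<ε ; ε<d , ∣y-x∣<ε = p N ℕₚ.≤-refl in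
    too-far (seq x N) (seq d N) ε<d (subst (λ h → ℚ.∣ h ℚ.- seq x N ∣ ℚ.< ε) (y≡x+d N) ∣y-x∣<ε)
    where
    too-far : ∀ x d → 0ℚ ℚ.+ ε ℚ.< d → ¬ ℚ.∣ x ℚ.+ d ℚ.- x ∣ ℚ.< ε
    too-far x d ε<d d<ε = ℚₚ.<-asym
      (subst (ℚ._< d) (ℚₚ.+-identityˡ ε) ε<d)
      (subst (ℚ._< ε) (trans (cong ℚ.∣_∣ (solve 2 (λ x d → (x :+ d) :- x := d) refl x d))
        (ℚₚ.0≤p⇒∣p∣≡p (ℚₚ.<⇒≤ (ℚₚ.<-trans 0<ε (subst (ℚ._< d) (ℚₚ.+-identityˡ ε) ε<d))))) d<ε)

-- The deviation from the secant

-- Only the sum of `t` enters; when it is twice `n`, the slope `c` drops out.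
∑-secant : ∀ {n} (t : Fin n → ℕ) b c →
  ℚ∑.sum (λ u → b ℚ.+ (ι (t u) ℚ.- ι 2) ℚ.* c) ≡ ι n ℚ.* b ℚ.+ (ι (sum t) ℚ.- ι n ℚ.* ι 2) ℚ.* c
∑-secant {zero}  t b c = solve 2 (λ b c → con 0ℚ := con 0ℚ :* b :+ (con 0ℚ :- con 0ℚ :* con (ι 2)) :* c)
  refl b c
∑-secant {suc n} t b c = begin
  b ℚ.+ (ι t₀ ℚ.- ι 2) ℚ.* c ℚ.+ ℚ∑.sum (λ u → b ℚ.+ (ι (t (fsuc u)) ℚ.- ι 2) ℚ.* c)
    ≡⟨ cong (b ℚ.+ (ι t₀ ℚ.- ι 2) ℚ.* c ℚ.+_) (∑-secant (t ∘ fsuc) b c) ⟩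
  b ℚ.+ (ι t₀ ℚ.- ι 2) ℚ.* c ℚ.+ (ι n ℚ.* b ℚ.+ (ι ts ℚ.- ι n ℚ.* ι 2) ℚ.* c)
    ≡⟨ add b c (ι t₀) (ι n) (ι ts) ⟩
  (1ℚ ℚ.+ ι n) ℚ.* b ℚ.+ ((ι t₀ ℚ.+ ι ts) ℚ.- (1ℚ ℚ.+ ι n) ℚ.* ι 2) ℚ.* c
    ≡⟨ cong₂ (λ h g → h ℚ.* b ℚ.+ (g ℚ.- h ℚ.* ι 2) ℚ.* c) (sym (ι-+ 1 n)) (sym (ι-+ t₀ ts)) ⟩
  ι (suc n) ℚ.* b ℚ.+ (ι (sum t) ℚ.- ι (suc n) ℚ.* ι 2) ℚ.* c ∎
  where
  open ≡-Reasoning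
  t₀ = t fzero
  ts = sum (t ∘ fsuc)
  add : ∀ b c t₀ n ts →
    b ℚ.+ (t₀ ℚ.- ι 2) ℚ.* c ℚ.+ (n ℚ.* b ℚ.+ (ts ℚ.- n ℚ.* ι 2) ℚ.* c) ≡
    (1ℚ ℚ.+ n) ℚ.* b ℚ.+ ((t₀ ℚ.+ ts) ℚ.- (1ℚ ℚ.+ n) ℚ.* ι 2) ℚ.* c
  add = solve 5 (λ b c t₀ n ts → b :+ (t₀ :- con (ι 2)) :* c :+ (n :* b :+ (ts :- n :* con (ι 2)) :* c)
          := (con 1ℚ :+ n) :* b :+ ((t₀ :+ ts) :- (con 1ℚ :+ n) :* con (ι 2)) :* c) refl

module _ (f : Func [1,∞[ ≃-setoid) where

  f₁ f₂ : ℝ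
  f₁ = apply f (natural 1 (s≤s z≤n))
  f₂ = apply f (natural 2 (s≤s z≤n))

  -- The secant is written from its value at 2, the mean degree of a unicyclic graph.
  deviation : ∀ d → 1 ℕ.≤ d → ℝ
  deviation d 1≤d = apply f (natural d 1≤d) - (f₂ + (fromℕ d - fromℕ 2) * (f₂ - f₁))

  deviation-1-2 : ∀ d 1≤d → d ℕ.≤ 2 → ∀ k → seq (deviation d 1≤d) k ≡ 0ℚ
  -- The value of `f` is taken at a point carrying a proof, which must first be made the one used in
  -- `f₁`.
  deviation-1-2 1 1≤1 _ k = subst (λ p → seq (deviation 1 p) k ≡ 0ℚ)
    (ℕₚ.≤-irrelevant (s≤s z≤n) 1≤1) (vanish (seq f₁ k) (seq f₂ k))
    where
    vanish : ∀ a b → a ℚ.- (b ℚ.+ (ι 1 ℚ.- ι 2) ℚ.* (b ℚ.- a)) ≡ 0ℚ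
    vanish = solve 2 (λ a b → a :- (b :+ (con (ι 1) :- con (ι 2)) :* (b :- a)) := con 0ℚ) refl
  deviation-1-2 2 1≤2 _ k = subst (λ p → seq (deviation 2 p) k ≡ 0ℚ)
    (ℕₚ.≤-irrelevant (s≤s z≤n) 1≤2) (vanish (seq f₁ k) (seq f₂ k))
    where
    vanish : ∀ a b → b ℚ.- (b ℚ.+ (ι 2 ℚ.- ι 2) ℚ.* (b ℚ.- a)) ≡ 0ℚ
    vanish = solve 2 (λ a b → b :- (b :+ (con (ι 2) :- con (ι 2)) :* (b :- a)) := con 0ℚ) refl
  deviation-1-2 (suc (suc (suc _))) _ (s≤s (s≤s ()))

  -- 2 = (1 - t) 1 + t (3 + e) for t = 1 / (2 + e)
  module _ (e : ℕ) (1≤d : 1 ℕ.≤ 3 ℕ.+ e) where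

    private
      d q : ℕ
      d = 3 ℕ.+ e
      q = 2 ℕ.+ e

      t : ℚ
      t = proj₁ (reciprocal (0<ι (suc e)))

      0<t : 0ℚ ℚ.< t
      0<t = proj₁ (proj₂ (reciprocal (0<ι (suc e))))

      qt≡1 : ι q ℚ.* t ≡ 1ℚ
      qt≡1 = proj₂ (proj₂ (reciprocal (0<ι (suc e))))

      t<1 : t ℚ.< 1ℚ
      t<1 = shift (ι (suc e)) t (trans (cong (ℚ._* t) (sym (ι-+ 1 (suc e)))) qt≡1) (0<* (0<ι e) 0<t)
        where
        shift : ∀ r t → (1ℚ ℚ.+ r) ℚ.* t ≡ 1ℚ → 0ℚ ℚ.< r ℚ.* t → t ℚ.< 1ℚ
        shift r t eq = <-shift {0ℚ} {r ℚ.* t}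
          (trans (solve 2 (λ r t → r :* t :- con 0ℚ := (con 1ℚ :+ r) :* t :- t) refl r t)
            (cong (ℚ._- t) eq))

      x y z : Σ ℝ (1ℝ ≤_)
      x = natural 1 (s≤s z≤n)
      y = natural d 1≤d
      z = natural 2 (s≤s z≤n)

      z-combination : proj₁ z ≃ (1ℝ - fromℚ t) * proj₁ x + fromℚ t * proj₁ y
      z-combination = ≗⇒≃ {proj₁ z} {(1ℝ - fromℚ t) * proj₁ x + fromℚ t * proj₁ y} λ _ →
        sym (combine (ι d) (ι q) t (ι-+ 1 q) qt≡1)
        where
        combine : ∀ d q t → d ≡ 1ℚ ℚ.+ q → q ℚ.* t ≡ 1ℚ → (1ℚ ℚ.- t) ℚ.* 1ℚ ℚ.+ t ℚ.* d ≡ 1ℚ ℚ.+ 1ℚ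
        combine _ q t refl qt≡1 = trans
          (solve 2 (λ q t → (con 1ℚ :- t) :* con 1ℚ :+ t :* (con 1ℚ :+ q) := con 1ℚ :+ q :* t) refl q t)
          (cong (1ℚ ℚ.+_) qt≡1)

      -- The deviation is the gap in the convexity inequality at 2, scaled by `q`, the inverse of
      -- `t`.
      deviation≡ : ∀ k → seq (deviation d 1≤d) k ≡
        ι q ℚ.* (((1ℚ ℚ.- t) ℚ.* seq f₁ k ℚ.+ t ℚ.* seq (apply f y) k) ℚ.- seq f₂ k)
      deviation≡ k = rescale (seq f₁ k) (seq f₂ k) (seq (apply f y) k) (ι d) (ι q) t (ι-+ 1 q) qt≡1
        where
        rescale : ∀ a b x d q t → d ≡ 1ℚ ℚ.+ q → q ℚ.* t ≡ 1ℚ →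
          x ℚ.- (b ℚ.+ (d ℚ.- ι 2) ℚ.* (b ℚ.- a)) ≡
          q ℚ.* (((1ℚ ℚ.- t) ℚ.* a ℚ.+ t ℚ.* x) ℚ.- b)
        rescale a b x _ q t refl qt≡1 = begin
          x ℚ.- (b ℚ.+ (1ℚ ℚ.+ q ℚ.- ι 2) ℚ.* (b ℚ.- a))
            ≡⟨ solve 4 (λ a b x q → x :- (b :+ (con 1ℚ :+ q :- con (ι 2)) :* (b :- a))
                 := ((q :- con 1ℚ) :* a :+ con 1ℚ :* x) :- q :* b) refl a b x q ⟩
          ((q ℚ.- 1ℚ) ℚ.* a ℚ.+ 1ℚ ℚ.* x) ℚ.- q ℚ.* b
            -- Writing 1 as `q * t` allows `q` to be factored out.
            ≡⟨ cong (λ h → ((q ℚ.- h) ℚ.* a ℚ.+ h ℚ.* x) ℚ.- q ℚ.* b) (sym qt≡1) ⟩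
          ((q ℚ.- q ℚ.* t) ℚ.* a ℚ.+ q ℚ.* t ℚ.* x) ℚ.- q ℚ.* b
            ≡⟨ solve 5 (λ a b x q t → ((q :- q :* t) :* a :+ q :* t :* x) :- q :* b
                 := q :* (((con 1ℚ :- t) :* a :+ t :* x) :- b)) refl a b x q t ⟩
          q ℚ.* (((1ℚ ℚ.- t) ℚ.* a ℚ.+ t ℚ.* x) ℚ.- b) ∎
          where open ≡-Reasoning

      mean : ℝ
      mean = (1ℝ - fromℚ t) * f₁ + fromℚ t * apply f y

    deviation-nonneg-≥3 : Convex f → 0ℝ ≤ deviation d 1≤d
    deviation-nonneg-≥3 convex = scale-≤ {f₂} {mean} {deviation d 1≤d} (0<ι (suc e)) deviation≡
      (convex x y z (fromℚ t) (<⇒≤ {0ℝ} {fromℚ t} (fromℚ-mono-< 0<t))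
        (<⇒≤ {fromℚ t} {1ℝ} (fromℚ-mono-< t<1)) z-combination)

    deviation-pos : StrictlyConvex f → 0ℝ < deviation d 1≤d
    deviation-pos convex = scale-< {f₂} {mean} {deviation d 1≤d} (0<ι (suc e)) deviation≡
      (convex x y z (fromℚ t) (inj₁ (fromℚ-mono-< 1<d)) (fromℚ-mono-< 0<t) (fromℚ-mono-< t<1) z-combination)
      where
      1<d : ι 1 ℚ.< ι d
      1<d = shift (ι d) (ι q) (ι-+ 1 q) (0<ι (suc e))
        where
        shift : ∀ d q → d ≡ 1ℚ ℚ.+ q → 0ℚ ℚ.< q → 1ℚ ℚ.< d
        shift _ q refl = <-shift {0ℚ} {q}
          (solve 1 (λ q → q :- con 0ℚ := (con 1ℚ :+ q) :- con 1ℚ) refl q)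

  deviation-nonneg : Convex f → ∀ d 1≤d → 0ℝ ≤ deviation d 1≤d
  deviation-nonneg convex 1 p = 0≤-zero {deviation 1 p} (deviation-1-2 1 p (s≤s z≤n))
  deviation-nonneg convex 2 p = 0≤-zero {deviation 2 p} (deviation-1-2 2 p (s≤s (s≤s z≤n)))
  deviation-nonneg convex (suc (suc (suc e))) p = deviation-nonneg-≥3 e p convex

  -- The excess of `I f G` over the bound

  module _ {n} (G : Graph (suc n)) (w : Fin (suc n)) where

    deviationAt : Fin (suc n) → ℝ
    deviationAt u = deviation (degree G u) (degree≥1 G u)

    -- `w` is left out because its value of `f` occurs in the bound itself.
    excess : ℝ
    excess = ∑ (removeAt deviationAt w)

    -- Split each value of `f` into secant and deviation. By the degree sum the secant part is the
    -- number of vertices times `f₂`, and adding the deviation at `w` turns it into the bound.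
    I≡bound+excess : ∀ {Δ} (1≤Δ : 1 ℕ.≤ Δ) → degree G w ≡ Δ → sum (degree G) ≡ suc n ℕ.+ suc n →
      ∀ k → seq (I f G) k ≡ seq (lowerBound f (suc n) Δ 1≤Δ) k ℚ.+ seq excess k
    I≡bound+excess 1≤Δ refl ∑deg k = begin
      seq (I f G) k
        ≡⟨ seq-∑ (λ u → apply f (natural (degree G u) (degree≥1 G u))) k ⟩
      ℚ∑.sum fd
        ≡⟨ ℚ∑.sum-cong-≗ (λ u → split (fd u) (line u)) ⟩
      ℚ∑.sum (λ u → line u ℚ.+ dev u)
        ≡⟨ ℚ∑.∑-distrib-+ line dev ⟩
      ℚ∑.sum line ℚ.+ ℚ∑.sum dev
        ≡⟨ cong₂ ℚ._+_ ∑line (ℚ∑.sum-remove {i = w} dev) ⟩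
      N ℚ.* b ℚ.+ (dev w ℚ.+ ℚ∑.sum (removeAt dev w))
        ≡⟨ cong (λ h → N ℚ.* b ℚ.+ (dev w ℚ.+ h)) (sym (seq-∑ (removeAt deviationAt w) k)) ⟩
      N ℚ.* b ℚ.+ (dev w ℚ.+ seq excess k)
        ≡⟨ collect a b (fd w) (ι (degree G w)) N (seq excess k) ⟩
      fd w ℚ.+ (N ℚ.- ι (degree G w) ℚ.+ 1ℚ) ℚ.* b ℚ.+ (ι (degree G w) ℚ.- ι 2) ℚ.* a ℚ.+ seq excess k
        ≡⟨⟩
      seq (lowerBound f (suc n) (degree G w) (degree≥1 G w)) k ℚ.+ seq excess k
        ≡⟨ cong (λ p → seq (lowerBound f (suc n) (degree G w) p) k ℚ.+ seq excess k)
             (ℕₚ.≤-irrelevant (degree≥1 G w) 1≤Δ) ⟩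
      seq (lowerBound f (suc n) (degree G w) 1≤Δ) k ℚ.+ seq excess k ∎
      where
      open ≡-Reasoning
      N a b : ℚ
      N = ι (suc n)
      a = seq f₁ k
      b = seq f₂ k
      fd line dev : Fin (suc n) → ℚ
      fd u = seq (apply f (natural (degree G u) (degree≥1 G u))) k
      line u = b ℚ.+ (ι (degree G u) ℚ.- ι 2) ℚ.* (b ℚ.- a)
      dev u = seq (deviationAt u) k
      split : ∀ x l → x ≡ l ℚ.+ (x ℚ.- l)
      split = solve 2 (λ x l → x := l :+ (x :- l)) refl
      collect : ∀ a b x d N e →
        N ℚ.* b ℚ.+ (x ℚ.- (b ℚ.+ (d ℚ.- ι 2) ℚ.* (b ℚ.- a)) ℚ.+ e) ≡
        x ℚ.+ (N ℚ.- d ℚ.+ 1ℚ) ℚ.* b ℚ.+ (d ℚ.- ι 2) ℚ.* a ℚ.+ e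
      collect = solve 6 (λ a b x d N e →
        N :* b :+ (x :- (b :+ (d :- con (ι 2)) :* (b :- a)) :+ e)
        := x :+ (N :- d :+ con 1ℚ) :* b :+ (d :- con (ι 2)) :* a :+ e) refl
      double : ∀ b c N → N ℚ.* b ℚ.+ ((N ℚ.+ N) ℚ.- N ℚ.* ι 2) ℚ.* c ≡ N ℚ.* b
      double = solve 3 (λ b c N → N :* b :+ ((N :+ N) :- N :* con (ι 2)) :* c := N :* b) refl
      ∑line : ℚ∑.sum line ≡ N ℚ.* b
      ∑line = begin
        ℚ∑.sum line
          ≡⟨ ∑-secant (degree G) b (b ℚ.- a) ⟩
        N ℚ.* b ℚ.+ (ι (sum (degree G)) ℚ.- N ℚ.* ι 2) ℚ.* (b ℚ.- a)
          ≡⟨ cong (λ h → N ℚ.* b ℚ.+ (h ℚ.- N ℚ.* ι 2) ℚ.* (b ℚ.- a))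
               (trans (cong ι ∑deg) (ι-+ (suc n) (suc n))) ⟩
        N ℚ.* b ℚ.+ ((N ℚ.+ N) ℚ.- N ℚ.* ι 2) ℚ.* (b ℚ.- a)
          ≡⟨ double b (b ℚ.- a) N ⟩
        N ℚ.* b ∎

    0≤deviationAt : Convex f → ∀ u → 0ℝ ≤ deviationAt u
    0≤deviationAt convex u = deviation-nonneg convex (degree G u) (degree≥1 G u)

    0≤excess : Convex f → 0ℝ ≤ excess
    0≤excess convex = 0≤∑ (removeAt deviationAt w) λ v → 0≤deviationAt convex (punchIn w v)

    degrees≤2⇒excess≡0 : (∀ v → v ≢ w → degree G v ℕ.≤ 2) → ∀ k → seq excess k ≡ 0ℚ
    degrees≤2⇒excess≡0 ≤2 k = begin
      seq excess k
        ≡⟨ seq-∑ (removeAt deviationAt w) k ⟩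
      ℚ∑.sum (λ v → seq (deviationAt (punchIn w v)) k)
        ≡⟨ ℚ∑.sum-cong-≗ (λ v → let u = punchIn w v in
             deviation-1-2 (degree G u) (degree≥1 G u) (≤2 u (Finₚ.punchInᵢ≢i w v)) k) ⟩
      ℚ∑.sum {n} (λ _ → 0ℚ)
        ≡⟨ ℚ∑.sum-replicate-zero n ⟩
      0ℚ ∎
      where open ≡-Reasoning

    0<deviationAt : StrictlyConvex f → ∀ u → 3 ℕ.≤ degree G u → 0ℝ < deviationAt u
    0<deviationAt strict u = positive (degree G u) (degree≥1 G u)
      where
      positive : ∀ d 1≤d → 3 ℕ.≤ d → 0ℝ < deviation d 1≤d
      positive 1 _ (s≤s ())
      positive 2 _ (s≤s (s≤s ()))
      positive (suc (suc (suc e))) 1≤d _ = deviation-pos e 1≤d strict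

    0<excess : Convex f → StrictlyConvex f → ∀ v → 3 ℕ.≤ degree G (punchIn w v) → 0ℝ < excess
    0<excess convex strict v 3≤ = 0<∑ (removeAt deviationAt w)
      (λ v′ → 0≤deviationAt convex (punchIn w v′)) v (0<deviationAt strict (punchIn w v) 3≤)

    -- Equality in the bound only refutes a positive excess; this is enough because comparison of
    -- degrees is decidable.
    ¬0<excess⇒degrees≤2 : Convex f → StrictlyConvex f → ¬ 0ℝ < excess →
      ∀ v → v ≢ w → degree G v ℕ.≤ 2
    ¬0<excess⇒degrees≤2 convex strict ¬0<excess v v≢w = ℕₚ.≮⇒≥ λ 3≤ → ¬0<excess
      (0<excess convex strict (punchOut w≢v)
        (subst (λ u → 3 ℕ.≤ degree G u) (sym (Finₚ.punchIn-punchOut w≢v)) 3≤))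
      where
      w≢v : w ≢ v
      w≢v = v≢w ∘ sym

-- The converse in the equality case is stated for strictly convex `f`, because for affine `f` every
-- deviation vanishes and equality always holds.
theorem4p3 : ∀ {n Δ : ℕ} (G : Graph n) → Unicyclic G → 4 ℕ.≤ n →
    MaximumDegree G Δ → (Δ≥3 : 3 ℕ.≤ Δ) →
    (f : Func [1,∞[ ≃-setoid) → Convex f →
    let bound = lowerBound f n Δ (m+n≤o⇒m≤o 1 Δ≥3) in
    bound ≤ I f G
    × (G ∈ℋ Δ → I f G ≃ bound)
    × (StrictlyConvex f → (I f G ≃ bound ⇔ G ∈ℋ Δ))
theorem4p3 {zero} G _ () 
theorem4p3 {suc n} {Δ} G (C , unique) _ (_ , w , deg-w) Δ≥3 f convex =
    0≤difference⇒≤ {bound} {I f G} {D} I≡bound+D (0≤excess f G w convex)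
  , ℋ⇒≃
  , λ strict → mk⇔ (λ I≃bound → Decomposition.G∈ℋ G C unique Δ≥3 deg-w
        (¬0<excess⇒degrees≤2 f G w convex strict λ 0<D →
          0<difference⇒≄ {bound} {I f G} {D} I≡bound+D 0<D I≃bound))
      ℋ⇒≃
  where
  bound D : ℝ
  bound = lowerBound f (suc n) Δ (m+n≤o⇒m≤o 1 Δ≥3)
  D = excess f G w
  I≡bound+D = I≡bound+excess f G w (m+n≤o⇒m≤o 1 Δ≥3) deg-w (Orientation.∑degree≡n+n G C unique)
  ℋ⇒≃ : G ∈ℋ Δ → I f G ≃ bound
  ℋ⇒≃ G∈ℋ = zero-difference⇒≃ {bound} {I f G} {D} I≡bound+D
    (degrees≤2⇒excess≡0 f G w (ℋ⇒degree≤2 G G∈ℋ (subst (3 ℕ.≤_) (sym deg-w) Δ≥3)))
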